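{- Let $T$ be a complete theory and $\phi(x,y)$ a formula. The following are equivalent: (1) $\phi(x,y)$ has IP. (2) There exist a model $M$ of $T$, a tuple $b\in M$ and $\sigma\in\mathrm{Aut}(M)$ such that, with $U=\phi(M,b)$, the set $\xi_{\sigma,U}(M)$ is dense in $2^{\mathbb{Z}}$. (3) There exist a model $M$ of $T$ and $\sigma\in\mathrm{Aut}(M)$ such that for every $n\in\mathbb{N}$ there is an instance $U_n=\phi(M,b_n)$, $b_n\in M$, such that every binary sequence of length $n$ appears as a subsequence of some element of $\xi_{\sigma,U_n}(M)$. (4) There exist a model $M$ of $T$, a tuple $b\in M$ and $\sigma\in\mathrm{Aut}(M)$ such that, with $U=\phi(M,b)$, $\xi_{\sigma,U}(M)$ contains a universal sequence. (5) There exist a model $M$ of $T$, a tuple $b\in M$ and $\sigma\in\mathrm{Aut}(M)$ such that, with $U=\phi(M,b)$, $\xi_{\sigma,U}(M)=2^{\mathbb{Z}}$. (6) There exists a model $M$ of $T$ such that $\rho_\phi(M)$ is dense in $2^{\mathbb{Z}}$.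
   Context: $\phi(x,y)$ has IP if in some model, for every $n$, there are $a_1,\dots,a_n$ such that for every $J\subseteq\{1,\dots,n\}$ there is $b_J$ with $\phi(a_i,b_J)\iff i\in J$. Subsets of $\mathbb{Z}$ are identified with binary $\mathbb{Z}$-sequences; $2^{\mathbb{Z}}$ has the product topology. For $\sigma\in\mathrm{Aut}(M)$ and $U\subseteq M$ (in the sort of $x$), $\xi_{\sigma,U}(a)=\{n\in\mathbb{Z}:\sigma^n(a)\in U\}$ and $\xi_{\sigma,U}(M)$ is its image. A finite binary sequence "appears as a subsequence" of a $\mathbb{Z}$-sequence if it occurs as a block of consecutive entries; a binary $\mathbb{Z}$-sequence is universal if every finite binary sequence appears in it in this sense. $\rho_\phi(M)=\bigcup_{b}\bigcup_{\sigma\in\mathrm{Aut}(M)}\xi_{\sigma,\phi(M,b)}(M)$, the union over all parameter tuples $b$ in $M$. -}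

module Defs where

open import Data.Bool using (Bool; true)
open import Data.Empty.Polymorphic using (⊥)
open import Data.Fin using (Fin; toℕ)
open import Data.Fin.Subset using (Subset) renaming (_∈_ to _∈ₛ_)
open import Data.Integer using (ℤ; +_; -[1+_]; _+_)
open import Data.List using (List)
open import Data.List.Relation.Unary.All using (All)
open import Data.Nat using (ℕ; suc) renaming (_+_ to _+ₙ_)
open import Data.Nat.GeneralisedArithmetic using (iterate)
open import Data.Product using (Σ-syntax; ∃-syntax; _×_)
open import Data.Sum using (_⊎_)
open import Data.Vec using (Vec; []; _∷_; _++_; lookup; map)
open import Function.Bundles using (_⇔_; _↔_; Inverse)
open import Level using (Level; 0ℓ; _⊔_) renaming (suc to lsuc)
open import Relation.Binary.PropositionalEquality using (_≡_)
open import Relation.Unary using (Pred; _∈_; Satisfiable; _≬_; ⋃)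

private
  variable
    ℓ : Level

record Language (ℓ : Level) : Set (lsuc ℓ) where
  field
    Fun : ℕ → Set ℓ
    Rel : ℕ → Set ℓ

open Language public

data Term (L : Language ℓ) (n : ℕ) : Set ℓ where
  var : Fin n → Term L n
  fun : ∀ {k} → Fun L k → Vec (Term L n) k → Term L n

infix  7 _≐_
infixr 6 _⇒_

-- Formulas whose free variables are among n de Bruijn indices; the bound
-- variable of `all` is index zero.  The remaining connectives are the usual
-- classical abbreviations.
data Formula (L : Language ℓ) : ℕ → Set ℓ where
  false : ∀ {n} → Formula L n
  _≐_   : ∀ {n} → Term L n → Term L n → Formula L n
  rel   : ∀ {n k} → Rel L k → Vec (Term L n) k → Formula L n
  _⇒_   : ∀ {n} → Formula L n → Formula L n → Formula L n
  all   : ∀ {n} → Formula L (suc n) → Formula L n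

neg : {L : Language ℓ} {n : ℕ} → Formula L n → Formula L n
neg φ = φ ⇒ false

Sentence : Language ℓ → Set ℓ
Sentence L = Formula L 0

Theory : Language ℓ → Set (lsuc ℓ)
Theory {ℓ} L = Pred (Sentence L) ℓ

-- `inhabited` only records that the universe is nonempty; the element it
-- names is not part of the structure and automorphisms may move it.
record Structure (L : Language ℓ) : Set (lsuc ℓ) where
  field
    Carrier   : Set ℓ
    inhabited : Carrier
    funᴹ      : ∀ {k} → Fun L k → Vec Carrier k → Carrier
    relᴹ      : ∀ {k} → Rel L k → Pred (Vec Carrier k) ℓ

open Structure public

module _ {L : Language ℓ} (M : Structure L) where

  mutual
    eval : ∀ {n} → Vec (Carrier M) n → Term L n → Carrier M
    eval v (var i)    = lookup v i
    eval v (fun f ts) = funᴹ M f (evals v ts)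

    evals : ∀ {n k} → Vec (Carrier M) n → Vec (Term L n) k → Vec (Carrier M) k
    evals v []       = []
    evals v (t ∷ ts) = eval v t ∷ evals v ts

infix 4 _⊨_[_] _⊨ᵀ_ _⊩_

_⊨_[_] : {L : Language ℓ} (M : Structure L) {n : ℕ} → Formula L n → Vec (Carrier M) n → Set ℓ
M ⊨ false    [ v ] = ⊥
M ⊨ s ≐ t    [ v ] = eval M v s ≡ eval M v t
M ⊨ rel r ts [ v ] = relᴹ M r (evals M v ts)
M ⊨ φ ⇒ ψ    [ v ] = M ⊨ φ [ v ] → M ⊨ ψ [ v ]
M ⊨ all φ    [ v ] = ∀ a → M ⊨ φ [ a ∷ v ]

_⊨ᵀ_ : {L : Language ℓ} → Structure L → Theory L → Set ℓ
M ⊨ᵀ T = ∀ ψ → ψ ∈ T → M ⊨ ψ [ [] ]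

record Model {L : Language ℓ} (T : Theory L) : Set (lsuc ℓ) where
  field
    structure : Structure L
    satisfies : structure ⊨ᵀ T

open Model public

_⊩_ : {L : Language ℓ} → Theory L → Sentence L → Set (lsuc ℓ)
T ⊩ ψ = (M : Model T) → structure M ⊨ ψ [ [] ]

record IsComplete {L : Language ℓ} (T : Theory L) : Set (lsuc ℓ) where
  field
    satisfiable : Model T
    decides     : ∀ ψ → (T ⊩ ψ) ⊎ (T ⊩ neg ψ)

record Automorphism {L : Language ℓ} (M : Structure L) : Set ℓ where
  field
    bijection : Carrier M ↔ Carrier M

  open Inverse bijection public using (to; from)

  field
    fun-preserved : ∀ {k} (f : Fun L k) xs → to (funᴹ M f xs) ≡ funᴹ M f (map to xs)
    rel-preserved : ∀ {k} (r : Rel L k) xs → relᴹ M r xs ⇔ relᴹ M r (map to xs)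

power : {L : Language ℓ} {M : Structure L} → Automorphism M → ℤ → Carrier M → Carrier M
power σ (+ n)    a = iterate (Automorphism.to σ) a n
power σ -[1+ n ] a = iterate (Automorphism.from σ) a (suc n)

-- In a formula φ(x , y) with ∣x∣ = p and ∣y∣ = q the variables x come first;
-- this is the set φ(M , b) ⊆ Mᵖ.
instanceAt : {L : Language ℓ} {p q : ℕ} (M : Structure L) →
             Formula L (p +ₙ q) → Vec (Carrier M) q → Pred (Vec (Carrier M) p) ℓ
instanceAt M φ b a = M ⊨ φ [ a ++ b ]

HasIP : {L : Language ℓ} → Theory L → (p q : ℕ) → Formula L (p +ₙ q) → Set (lsuc ℓ)
HasIP T p q φ =
  Σ[ 𝓜 ∈ Model T ] let M = structure 𝓜 in
  ∀ (n : ℕ) → Σ[ a ∈ (Fin n → Vec (Carrier M) p) ]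
  ∀ (J : Subset n) → Σ[ b ∈ Vec (Carrier M) q ]
  ∀ (i : Fin n) → (a i ∈ instanceAt M φ b) ⇔ (i ∈ₛ J)

2^ℤ : Set
2^ℤ = ℤ → Bool

-- s is the binary sequence identified with the subset P of ℤ.
_Indicates_ : 2^ℤ → Pred ℤ ℓ → Set ℓ
s Indicates P = ∀ n → (s n ≡ true) ⇔ (n ∈ P)

-- Open sets of the product topology (Bool discrete): every point has a basic
-- neighbourhood, given by fixing finitely many coordinates, inside W.
IsOpen : Pred 2^ℤ 0ℓ → Set
IsOpen W = ∀ s → s ∈ W → Σ[ F ∈ List ℤ ] (∀ t → All (λ n → t n ≡ s n) F → t ∈ W)

IsDense : Pred 2^ℤ ℓ → Set (lsuc 0ℓ ⊔ ℓ)
IsDense D = ∀ (W : Pred 2^ℤ 0ℓ) → IsOpen W → Satisfiable W → W ≬ D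

_AppearsIn_ : {n : ℕ} → Vec Bool n → 2^ℤ → Set
w AppearsIn s = Σ[ k ∈ ℤ ] (∀ i → s (k + + toℕ i) ≡ lookup w i)

IsUniversal : 2^ℤ → Set
IsUniversal s = ∀ {n} (w : Vec Bool n) → w AppearsIn s

module _ {L : Language ℓ} {M : Structure L} {p : ℕ} where

  ξ : Automorphism M → Pred (Vec (Carrier M) p) ℓ → Vec (Carrier M) p → Pred ℤ ℓ
  ξ σ U a n = map (power σ n) a ∈ U

  ξ-image : Automorphism M → Pred (Vec (Carrier M) p) ℓ → Pred 2^ℤ ℓ
  ξ-image σ U s = ∃[ a ] (s Indicates ξ σ U a)

ρ : {L : Language ℓ} {p q : ℕ} → Formula L (p +ₙ q) → (M : Structure L) → Pred 2^ℤ ℓ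
ρ {p = p} {q} φ M = ⋃[ b ∶ Vec (Carrier M) q ] ⋃[ σ ∶ Automorphism M ] ξ-image σ (instanceAt {p = p} M φ b)

module _ {L : Language ℓ} (T : Theory L) (p q : ℕ) (φ : Formula L (p +ₙ q)) where

  private
    φ⟨_,_⟩ : (M : Structure L) → Vec (Carrier M) q → Pred (Vec (Carrier M) p) ℓ
    φ⟨ M , b ⟩ = instanceAt M φ b

  SomeDenseImage : Set (lsuc ℓ)
  SomeDenseImage =
    Σ[ 𝓜 ∈ Model T ] let M = structure 𝓜 in
    Σ[ b ∈ Vec (Carrier M) q ] Σ[ σ ∈ Automorphism M ]
    IsDense (ξ-image σ φ⟨ M , b ⟩)

  AllFiniteBlocksAppear : Set (lsuc ℓ)
  AllFiniteBlocksAppear =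
    Σ[ 𝓜 ∈ Model T ] let M = structure 𝓜 in
    Σ[ σ ∈ Automorphism M ]
    ∀ (n : ℕ) → Σ[ b ∈ Vec (Carrier M) q ]
    ∀ (w : Vec Bool n) → ∃[ s ] (s ∈ ξ-image σ φ⟨ M , b ⟩ × w AppearsIn s)

  SomeUniversalSequence : Set (lsuc ℓ)
  SomeUniversalSequence =
    Σ[ 𝓜 ∈ Model T ] let M = structure 𝓜 in
    Σ[ b ∈ Vec (Carrier M) q ] Σ[ σ ∈ Automorphism M ]
    ∃[ s ] (s ∈ ξ-image σ φ⟨ M , b ⟩ × IsUniversal s)

  SomeFullImage : Set (lsuc ℓ)
  SomeFullImage =
    Σ[ 𝓜 ∈ Model T ] let M = structure 𝓜 in
    Σ[ b ∈ Vec (Carrier M) q ] Σ[ σ ∈ Automorphism M ]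
    (∀ s → s ∈ ξ-image σ φ⟨ M , b ⟩)

  SomeDenseρ : Set (lsuc ℓ)
  SomeDenseρ = Σ[ 𝓜 ∈ Model T ] IsDense (ρ {p = p} {q} φ (structure 𝓜))

{-# OPTIONS --safe #-}

-- (1) ⇒ (5).  Excluded middle for arbitrary types acts as a choice operator,
-- so there is a nonprincipal ultrafilter D on ℕ.  By duality, a model M
-- witnessing IP contains for every m parameters b(m,0), …, b(m,m-1) all of whose
-- subsets are cut out by some φ(a,y).  Consider functions f(k,x,m) into M, with
-- k, m ∈ ℕ and x ∈ ℕ^ℤ, that for each k depend on finitely many coordinates
-- of x, modulo the iterated quantifier "D k, D x₋ₙ, …, D xₙ, D m" for all large
-- n.  By the argument of Łoś this is a model of T, and shifting x is an
-- automorphism σ of it.  Almost every x is strictly increasing and below m, so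
-- the parameters b(m,xᵢ) are distinct members of a shattered family; hence every
-- s ∈ 2^ℤ is realised over b = b(m,x₀) by the function choosing an a
-- with φ(a,b(m,x₋ᵢ)) ⇔ s(i) for ∣i∣ ≤ k.
--
-- Conversely, each of (2)–(6) yields for every n some σ and b such that all words
-- of length n occur in ξ_{σ,φ(M,b)}(M).  Moving the powers of σ onto b
-- shows that the translates of b are shattered, and duality gives IP.
module Submission where

open import Defs
open import Axiom.ExcludedMiddle using (ExcludedMiddle)
open import Axiom.Extensionality.Propositional using (Extensionality)
open import Axiom.UniquenessOfIdentityProofs.WithK using (uip)
open import Data.Bool using (Bool; true; false; not; _∧_; _∨_; if_then_else_)
open import Data.Bool.Properties using (∨-zeroʳ)
open import Data.Fin using (Fin; zero; suc; toℕ; fromℕ<; finToFun; funToFin)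
open import Data.Fin.Properties using (finToFun-funToFin; toℕ-fromℕ<)
open import Data.Fin.Subset using (Subset) renaming (_∈_ to _∈ₛ_)
open import Data.Integer as ℤ using (ℤ; +_; -[1+_]; ∣_∣)
import Data.Integer.Properties as ℤₚ
open import Data.List as List using (List; []; _∷_)
import Data.List.Properties as Listₚ
open import Data.List.Relation.Unary.All as All using (All; []; _∷_)
import Data.List.Relation.Unary.All.Properties as Allₚ
open import Data.Nat as ℕ using (ℕ; zero; suc; _+_; _≤_; _<_; _⊔_; s≤s)
open import Data.Nat.GeneralisedArithmetic using (iterate)
open import Data.Nat.Properties as ℕₚ using (≤-refl; ≤-trans; m≤m⊔n; m≤n⊔m)
open import Data.Product using (Σ-syntax; ∃-syntax; _×_; _,_; proj₁; proj₂)
open import Data.Sum using (_⊎_; inj₁; inj₂)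
open import Data.Vec as Vec using (Vec; []; _∷_; map; lookup; _++_; tabulate; head; tail)
open import Data.Vec.Properties using (lookup-map; lookup∘tabulate; lookup⇒[]=; []=⇒lookup; map-++; map-∘; map-cong; map-id)
open import Function using (_∘_; case_of_; flip)
open import Function.Bundles using (_⇔_; mk⇔; mk↔ₛ′; Equivalence; Inverse)
open import Function.Properties.Equivalence using () renaming (trans to ⇔-trans; sym to ⇔-sym; refl to ⇔-refl)
open import Level using (Level)
open import Relation.Binary.Definitions using (tri<; tri≈; tri>)
open import Relation.Binary.PropositionalEquality using (_≡_; _≢_; refl; sym; trans; cong; cong₂; subst; module ≡-Reasoning)
open import Relation.Nullary using (¬_; Dec; yes; no; does; contradiction)

open Equivalence using (to; from)

private variable
  a b c ℓ : Level
  I I′ : Set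

-- Shattered families and duality

≡⇒⇔ : {A : Set a} (P : A → Set b) {x y : A} → x ≡ y → P x ⇔ P y
≡⇒⇔ P refl = ⇔-refl

Shatters : {A : Set a} {B : Set b} → (A → B → Set c) → Set _
Shatters {A = A} {B} R = ∀ n → Σ[ x ∈ (Fin n → A) ] ∀ (J : Subset n) → Σ[ y ∈ B ] ∀ i → R (x i) y ⇔ (i ∈ₛ J)

∈⇔lookup : ∀ {n} (i : Fin n) (J : Subset n) → (i ∈ₛ J) ⇔ (lookup J i ≡ true)
∈⇔lookup i J = mk⇔ []=⇒lookup (lookup⇒[]= i J)

-- Take the points indexed by all subsets of Fin n; the parameter b i
-- picks out those subsets that contain i.
dual : {A : Set a} {B : Set b} (R : A → B → Set c) → Shatters R → Shatters (flip R)
dual R sh n = (λ i → proj₁ (par i)) , λ J → x (code J) , λ i → ⇔-trans (proj₂ (par i) (code J))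
    (⇔-trans (∈⇔lookup (code J) (containing i))
      (⇔-trans (≡⇒⇔ (_≡ true) (lookup-containing i J)) (⇔-sym (∈⇔lookup i J))))
  where
  bit : Bool → Fin 2
  bit true  = suc zero
  bit false = zero
  isOne : Fin 2 → Bool
  isOne zero    = false
  isOne (suc _) = true
  isOne-bit : ∀ t → isOne (bit t) ≡ t
  isOne-bit true  = refl
  isOne-bit false = refl
  x = proj₁ (sh (2 ℕ.^ n))
  code : Subset n → Fin (2 ℕ.^ n)
  code J = funToFin (bit ∘ lookup J)
  containing : Fin n → Subset (2 ℕ.^ n)
  containing i = tabulate (λ c → isOne (finToFun c i))
  lookup-containing : ∀ i J → lookup (containing i) (code J) ≡ lookup J i
  lookup-containing i J = trans (lookup∘tabulate (λ c → isOne (finToFun c i)) (code J))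
    (trans (cong isOne (finToFun-funToFin (bit ∘ lookup J) i)) (isOne-bit (lookup J i)))
  par = λ i → proj₂ (sh (2 ℕ.^ n)) (containing i)

collect : {A : Set a} (n : ℕ) → (Vec Bool n → List A) → List A
collect zero    g = g []
collect (suc n) g = collect n (g ∘ (true ∷_)) List.++ collect n (g ∘ (false ∷_))

-- Both uses need `g w` only as a contiguous piece: as a word inside a prefix of the universal
-- sequence, and as a sublist of the coordinates fixed by a basic open set.
collect-split : {A : Set a} {n : ℕ} (g : Vec Bool n → List A) (w : Vec Bool n) →
                ∃[ xs ] ∃[ ys ] collect n g ≡ xs List.++ g w List.++ ys
collect-split g [] = [] , [] , sym (Listₚ.++-identityʳ (g []))
collect-split {n = suc n} g (true ∷ w) with collect-split (g ∘ (true ∷_)) w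
... | xs , ys , eq = xs , ys List.++ rest , trans (cong (List._++ rest) eq)
        (trans (Listₚ.++-assoc xs _ rest) (cong (xs List.++_) (Listₚ.++-assoc (g (true ∷ w)) ys rest)))
  where rest = collect n (g ∘ (false ∷_))
collect-split {n = suc n} g (false ∷ w) with collect-split (g ∘ (false ∷_)) w
... | xs , ys , eq = start List.++ xs , ys , trans (cong (start List.++_) eq) (sym (Listₚ.++-assoc start xs _))
  where start = collect n (g ∘ (true ∷_))

-- Universal sequences

nth : ℕ → List Bool → Bool
nth _       []       = false
nth zero    (x ∷ _)  = x
nth (suc n) (_ ∷ xs) = nth n xs

nth-toList : ∀ {n} xs (w : Vec Bool n) ys i →
             nth (List.length xs + toℕ i) (xs List.++ Vec.toList w List.++ ys) ≡ lookup w i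
nth-toList []       (x ∷ w) ys zero    = refl
nth-toList []       (x ∷ w) ys (suc i) = nth-toList [] w ys i
nth-toList (_ ∷ xs) w       ys i       = nth-toList xs w ys i

-- The extra letter only makes the prefixes grow.
prefix : ℕ → List Bool
prefix zero    = []
prefix (suc n) = prefix n List.++ true ∷ collect n Vec.toList

prefix-length : ∀ n → n ≤ List.length (prefix n)
prefix-length zero    = ℕ.z≤n
prefix-length (suc n) = subst (suc n ≤_) (sym (Listₚ.length-++ (prefix n)))
  (≤-trans (s≤s (≤-trans (prefix-length n) (ℕₚ.m≤m+n _ _))) (ℕₚ.≤-reflexive (sym (ℕₚ.+-suc _ _))))

prefix-extends : ∀ n d → ∃[ zs ] prefix (d + n) ≡ prefix n List.++ zs
prefix-extends n zero    = [] , sym (Listₚ.++-identityʳ (prefix n))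
prefix-extends n (suc d) with prefix-extends n d
... | zs , eq = zs List.++ block , trans (cong (List._++ block) eq) (Listₚ.++-assoc (prefix n) zs block)
  where block = true ∷ collect (d + n) Vec.toList

-- By `prefix-length` the chosen prefix is longer than `∣ z ∣`, so the default of `nth` is never
-- reached. The negative half mirrors the other one, where every word is already found.
universal : 2^ℤ
universal z = nth ∣ z ∣ (prefix (suc ∣ z ∣))

universal-isUniversal : IsUniversal universal
universal-isUniversal {n} w with collect-split Vec.toList w
... | xs , ys , eq = + List.length start , found
  where
  open ≡-Reasoning
  start = prefix n List.++ true ∷ xs
  n≤start : n ≤ List.length start
  n≤start = ≤-trans (prefix-length n) (subst (List.length (prefix n) ≤_) (sym (Listₚ.length-++ (prefix n))) (ℕₚ.m≤m+n _ _))
  found : ∀ i → universal (+ List.length start ℤ.+ + toℕ i) ≡ lookup w i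
  -- The position `k` is at least `n`, so `prefix (suc k)` extends `prefix (suc n)`, whose last
  -- block already contains `w`.
  found i with prefix-extends (suc n) (k ℕ.∸ n)
    where k = List.length start + toℕ i
  ... | zs , ext = trans (cong (nth k) shape) (nth-toList start w (ys List.++ zs) i)
    where
    k = List.length start + toℕ i
    shape : prefix (suc k) ≡ start List.++ Vec.toList w List.++ ys List.++ zs
    shape = begin
      prefix (suc k)                ≡⟨ cong prefix (trans (ℕₚ.+-suc (k ℕ.∸ n) n)
                                         (cong suc (ℕₚ.m∸n+n≡m (≤-trans n≤start (ℕₚ.m≤m+n _ _))))) ⟨
      prefix (k ℕ.∸ n + suc n)    ≡⟨ ext ⟩
      (prefix n List.++ true ∷ collect n Vec.toList) List.++ zs
                                    ≡⟨ cong (λ c → (prefix n List.++ true ∷ c) List.++ zs) eq ⟩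
      (prefix n List.++ (true ∷ xs) List.++ Vec.toList w List.++ ys) List.++ zs
                                    ≡⟨ cong (List._++ zs) (Listₚ.++-assoc (prefix n) (true ∷ xs) _) ⟨
      (start List.++ Vec.toList w List.++ ys) List.++ zs
                                    ≡⟨ Listₚ.++-assoc start (Vec.toList w List.++ ys) zs ⟩
      start List.++ (Vec.toList w List.++ ys) List.++ zs
                                    ≡⟨ cong (start List.++_) (Listₚ.++-assoc (Vec.toList w) ys zs) ⟩
      start List.++ Vec.toList w List.++ ys List.++ zs ∎

occurrence : ∀ {n} → Vec Bool n → List ℤ
occurrence {n} w = List.tabulate {n = n} λ i → proj₁ (universal-isUniversal w) ℤ.+ + toℕ i

appears-if-agrees : ∀ {n} (w : Vec Bool n) s →
                    All (λ z → s z ≡ universal z) (occurrence w) → w AppearsIn s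
appears-if-agrees w s agree = let k , found = universal-isUniversal w in
  k , λ i → trans (Allₚ.tabulate⁻ agree i) (found i)

-- A dense set meets the basic open set around the universal sequence that
-- fixes one occurrence of every word of length n.
dense⇒words : {D : 2^ℤ → Set ℓ} → IsDense D → ∀ n →
              Σ[ s ∈ 2^ℤ ] (D s × ∀ (w : Vec Bool n) → w AppearsIn s)
dense⇒words dense n =
  let s , s∈ , Ds = dense agrees (λ s s∈ → F , λ t t≈s → All.zipWith (λ (p , q) → trans p q) (t≈s , s∈))
                                 (universal , All.universal (λ _ → refl) F)
  in s , Ds , λ w → appears-if-agrees w s (restrict s w s∈)
  where
  F : List ℤ
  F = collect n occurrence
  agrees : 2^ℤ → Set
  agrees t = All (λ z → t z ≡ universal z) F
  restrict : ∀ s w → agrees s → All (λ z → s z ≡ universal z) (occurrence w)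
  restrict s w s∈ = let xs , ys , eq = collect-split occurrence w in
    Allₚ.++⁻ˡ (occurrence w) (Allₚ.++⁻ʳ xs (subst (All _) eq s∈))

-- Automorphisms

iterate-comm : {A : Set a} (f : A → A) (x : A) (n : ℕ) → iterate f (f x) n ≡ f (iterate f x n)
iterate-comm f x zero    = refl
iterate-comm f x (suc n) = iterate-comm f (f x) n

module _ {L : Language ℓ} {M : Structure L} (σ : Automorphism M) where

  open Automorphism σ using (bijection; fun-preserved; rel-preserved) renaming (to to σ→; from to σ←)

  σ→σ← : ∀ x → σ→ (σ← x) ≡ x
  σ→σ← = Inverse.strictlyInverseˡ bijection

  σ→-injective : ∀ {x y} → σ→ x ≡ σ→ y → x ≡ y
  σ→-injective {x} {y} eq = trans (sym (Inverse.strictlyInverseʳ bijection x))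
    (trans (cong σ← eq) (Inverse.strictlyInverseʳ bijection y))

  mutual
    eval-σ : ∀ {n} (v : Vec (Carrier M) n) t → eval M (map σ→ v) t ≡ σ→ (eval M v t)
    eval-σ v (var i)    = lookup-map i σ→ v
    eval-σ v (fun f ts) = trans (cong (funᴹ M f) (evals-σ v ts)) (sym (fun-preserved f _))

    evals-σ : ∀ {n k} (v : Vec (Carrier M) n) (ts : Vec (Term L n) k) → evals M (map σ→ v) ts ≡ map σ→ (evals M v ts)
    evals-σ v []       = refl
    evals-σ v (t ∷ ts) = cong₂ Vec._∷_ (eval-σ v t) (evals-σ v ts)

  -- Induction on the formula: injectivity serves equations, surjectivity serves quantifiers, and
  -- proving both directions at once lets implication through.
  ⊨-σ : ∀ {n} (ψ : Formula L n) v → (M ⊨ ψ [ v ]) ⇔ (M ⊨ ψ [ map σ→ v ])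
  ⊨-σ false v = ⇔-refl
  ⊨-σ (s ≐ t) v = mk⇔
    (λ eq → trans (eval-σ v s) (trans (cong σ→ eq) (sym (eval-σ v t))))
    (λ eq → σ→-injective (trans (sym (eval-σ v s)) (trans eq (eval-σ v t))))
  ⊨-σ (rel r ts) v = ⇔-trans (rel-preserved r _) (≡⇒⇔ (relᴹ M r) (sym (evals-σ v ts)))
  ⊨-σ (ψ ⇒ χ) v = mk⇔
    (λ h → to (⊨-σ χ v) ∘ h ∘ from (⊨-σ ψ v))
    (λ h → from (⊨-σ χ v) ∘ h ∘ to (⊨-σ ψ v))
  ⊨-σ (all ψ) v = mk⇔
    (λ h x → subst (λ z → M ⊨ ψ [ z ∷ map σ→ v ]) (σ→σ← x) (to (⊨-σ ψ (σ← x ∷ v)) (h (σ← x))))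
    (λ h x → from (⊨-σ ψ (x ∷ v)) (h (σ→ x)))

  ⊨-iterate : ∀ i {n} (ψ : Formula L n) v → (M ⊨ ψ [ v ]) ⇔ (M ⊨ ψ [ map (λ x → iterate σ→ x i) v ])
  ⊨-iterate zero    ψ v = ≡⇒⇔ (λ z → M ⊨ ψ [ z ]) (sym (map-id v))
  ⊨-iterate (suc i) ψ v = ⇔-trans (⊨-σ ψ v) (⇔-trans (⊨-iterate i ψ (map σ→ v))
    (≡⇒⇔ (λ z → M ⊨ ψ [ z ]) (sym (map-∘ (λ x → iterate σ→ x i) σ→ v))))

  σ-power : ∀ k x → σ→ (power σ k x) ≡ power σ (ℤ.suc k) x
  σ-power (+ n)        x = sym (iterate-comm σ→ x n)
  σ-power -[1+ zero ]  x = σ→σ← x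
  σ-power -[1+ suc n ] x = trans (cong σ→ (iterate-comm σ← (σ← x) n)) (σ→σ← _)

  iterate-power : ∀ i k x → iterate σ→ (power σ k x) i ≡ power σ (k ℤ.+ + i) x
  iterate-power zero    k x = cong (λ z → power σ z x) (sym (ℤₚ.+-identityʳ k))
  iterate-power (suc i) k x = trans (cong (λ y → iterate σ→ y i) (σ-power k x))
    (trans (iterate-power i (ℤ.suc k) x) (cong (λ z → power σ z x)
      (trans (cong (ℤ._+ + i) (ℤₚ.+-comm ℤ.1ℤ k)) (ℤₚ.+-assoc k ℤ.1ℤ (+ i)))))

  iterate-inverse : ∀ i x → iterate σ→ (iterate σ← x i) i ≡ x
  iterate-inverse zero    x = refl
  iterate-inverse (suc i) x = begin
    iterate σ→ (σ→ (iterate σ← (σ← x) i)) i    ≡⟨ cong (λ y → iterate σ→ (σ→ y) i) (iterate-comm σ← x i) ⟩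
    iterate σ→ (σ→ (σ← (iterate σ← x i))) i    ≡⟨ cong (λ y → iterate σ→ y i) (σ→σ← _) ⟩
    iterate σ→ (iterate σ← x i) i              ≡⟨ iterate-inverse i x ⟩
    x                                          ∎
    where open ≡-Reasoning

  module _ (p q : ℕ) (φ : Formula L (p + q)) where

    -- Apply the `i`-th power of `σ` to all free variables: it cancels the inverse power on `y` and
    -- raises the exponent on `x`. Moving the parameter thus becomes moving along the sequence of
    -- `x`.
    move : ∀ i k (x : Vec (Carrier M) p) (y : Vec (Carrier M) q) →
           (M ⊨ φ [ map (power σ k) x ++ map (λ z → iterate σ← z i) y ]) ⇔
           (M ⊨ φ [ map (power σ (k ℤ.+ + i)) x ++ y ])
    move i k x y = ⇔-trans (⊨-iterate i φ _) (≡⇒⇔ (λ z → M ⊨ φ [ z ])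
      (trans (map-++ _ (map (power σ k) x) _) (cong₂ _++_
        (trans (sym (map-∘ _ (power σ k) x)) (map-cong (iterate-power i k) x))
        (trans (sym (map-∘ _ _ y)) (trans (map-cong (iterate-inverse i) y) (map-id y))))))

-- From finite blocks to IP, and consequences of a full image

module _ {L : Language ℓ} (T : Theory L) (p q : ℕ) (φ : Formula L (p + q)) where

  -- Here `σ` and `y` may vary with `n`, so that density of the union over all parameters and
  -- automorphisms suffices too. If `J`, read as a word, occurs at `k`, then the `k`-th translate of
  -- `x` cuts `J` out of the backward translates of `y`; this shatters the flipped relation.
  blocks⇒IP : (𝓜 : Model T) → let M = structure 𝓜 in
    (∀ n → Σ[ σ ∈ Automorphism M ] Σ[ y ∈ Vec (Carrier M) q ]
       ∀ (w : Vec Bool n) → ∃[ s ] (ξ-image σ (instanceAt {p = p} M φ y) s × w AppearsIn s)) →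
    HasIP T p q φ
  blocks⇒IP 𝓜 h = 𝓜 , dual (λ y x → instanceAt {p = p} (structure 𝓜) φ y x) λ n →
    let σ , y , words = h n in
    (λ i → map (λ z → iterate (Automorphism.from σ) z (toℕ i)) y) , λ J →
    let s , (x , ind) , k , appears = words J in
    map (power σ k) x , λ i → ⇔-trans (move σ p q φ (toℕ i) k x y)
      (⇔-trans (⇔-sym (ind (k ℤ.+ + toℕ i)))
        (⇔-trans (≡⇒⇔ (_≡ true) (appears i)) (⇔-sym (∈⇔lookup i J))))

  denseImage⇒IP : SomeDenseImage T p q φ → HasIP T p q φ
  denseImage⇒IP (𝓜 , y , σ , dense) = blocks⇒IP 𝓜 λ n →
    let s , s∈ , words = dense⇒words dense n in σ , y , λ w → s , s∈ , words w

  blocksAppear⇒IP : AllFiniteBlocksAppear T p q φ → HasIP T p q φ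
  blocksAppear⇒IP (𝓜 , σ , h) = blocks⇒IP 𝓜 λ n → σ , h n

  universal⇒IP : SomeUniversalSequence T p q φ → HasIP T p q φ
  universal⇒IP (𝓜 , y , σ , s , s∈ , univ) = blocks⇒IP 𝓜 λ n → σ , y , λ w → s , s∈ , univ w

  denseρ⇒IP : SomeDenseρ T p q φ → HasIP T p q φ
  denseρ⇒IP (𝓜 , dense) = blocks⇒IP 𝓜 λ n →
    let s , (y , σ , s∈) , words = dense⇒words dense n in σ , y , λ w → s , s∈ , words w

  full⇒denseImage : SomeFullImage T p q φ → SomeDenseImage T p q φ
  full⇒denseImage (𝓜 , y , σ , full) = 𝓜 , y , σ , λ W _ (s , s∈W) → s , s∈W , full s

  full⇒universal : SomeFullImage T p q φ → SomeUniversalSequence T p q φ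
  full⇒universal (𝓜 , y , σ , full) = 𝓜 , y , σ , universal , full universal , universal-isUniversal

  full⇒blocksAppear : SomeFullImage T p q φ → AllFiniteBlocksAppear T p q φ
  full⇒blocksAppear (𝓜 , y , σ , full) = 𝓜 , σ , λ n → y , λ w →
    universal , full universal , universal-isUniversal w

  full⇒denseρ : SomeFullImage T p q φ → SomeDenseρ T p q φ
  full⇒denseρ (𝓜 , y , σ , full) = 𝓜 , λ W _ (s , s∈W) → s , s∈W , y , σ , full s

-- Choice and ultrafilters

module Classical (em : ∀ {a : Level} → ExcludedMiddle a)
                 (fe : ∀ {a b : Level} → Extensionality a b) where

  stable : {P : Set a} → ¬ ¬ P → P
  stable {P = P} ¬¬p with em {P = P}
  ... | yes p = p
  ... | no ¬p = contradiction ¬p ¬¬p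

  ¬∀⟶∃¬ : {A : Set a} {P : A → Set b} → ¬ (∀ x → P x) → ∃[ x ] ¬ P x
  ¬∀⟶∃¬ ¬∀ = stable λ ¬∃ → ¬∀ λ x → stable λ ¬p → ¬∃ (x , ¬p)

  -- Collapsing propositions of every level to `Bool` makes power sets small: subsets, families of
  -- subsets and ultrafilters on a `Set` all stay in `Set`.
  ⌊_⌋ : Set a → Bool
  ⌊ P ⌋ = does (em {P = P})

  ⌊⌋-true : {P : Set a} → P → ⌊ P ⌋ ≡ true
  ⌊⌋-true {P = P} p with em {P = P}
  ... | yes _ = refl
  ... | no ¬p = contradiction p ¬p

  ⌊⌋-holds : {P : Set a} → ⌊ P ⌋ ≡ true → P
  ⌊⌋-holds {P = P} eq with em {P = P}
  ... | yes p = p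
  ⌊⌋-holds () | no _

  true-iff : {x y : Bool} → (x ≡ true → y ≡ true) → (y ≡ true → x ≡ true) → x ≡ y
  true-iff {true}  {y}     f g = sym (f refl)
  true-iff {false} {true}  f g = g refl
  true-iff {false} {false} f g = refl

  ⌊⌋-cong : {P : Set a} {Q : Set b} → (P → Q) → (Q → P) → ⌊ P ⌋ ≡ ⌊ Q ⌋
  ⌊⌋-cong f g = true-iff (⌊⌋-true ∘ f ∘ ⌊⌋-holds) (⌊⌋-true ∘ g ∘ ⌊⌋-holds)

  ⌊⌋-not : {P : Set a} → ⌊ (¬ P) ⌋ ≡ not ⌊ P ⌋
  ⌊⌋-not {P = P} with em {P = P}
  ... | yes p = true-iff (λ eq → contradiction p (⌊⌋-holds eq)) λ ()
  ... | no ¬p = ⌊⌋-true ¬p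

  -- The tower of a map f on subsets of X is the least family closed under f
  -- and unions; it is a chain because f is inflationary (Bourbaki–Witt).
  module Tower {X : Set} (f : (X → Bool) → X → Bool) where

    _⊆_ : (X → Bool) → (X → Bool) → Set
    A ⊆ B = ∀ x → A x ≡ true → B x ≡ true

    ⊆-antisym : ∀ {A B} → A ⊆ B → B ⊆ A → A ≡ B
    ⊆-antisym A⊆B B⊆A = fe λ x → true-iff (A⊆B x) (B⊆A x)

    ⋃ : ((X → Bool) → Bool) → X → Bool
    ⋃ 𝒞 x = ⌊ (∃[ A ] (𝒞 A ≡ true × A x ≡ true)) ⌋

    ⊆-⋃ : ∀ {𝒞 A} → 𝒞 A ≡ true → A ⊆ ⋃ 𝒞
    ⊆-⋃ A∈𝒞 x Ax = ⌊⌋-true (_ , A∈𝒞 , Ax)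

    ⋃-⊆ : ∀ {𝒞 B} → (∀ A → 𝒞 A ≡ true → A ⊆ B) → ⋃ 𝒞 ⊆ B
    ⋃-⊆ 𝒞⊆B x ⋃x = let A , A∈𝒞 , Ax = ⌊⌋-holds ⋃x in 𝒞⊆B A A∈𝒞 x Ax

    data Tower : (X → Bool) → Set where
      step : ∀ {A} → Tower A → Tower (f A)
      join : ∀ 𝒞 → (∀ A → 𝒞 A ≡ true → Tower A) → Tower (⋃ 𝒞)

    module _ (inflate : ∀ A → A ⊆ f A) where

      -- The extreme points of the Bourbaki-Witt argument: from strictly below `A`, the map `f`
      -- cannot jump past `A`.
      Extreme : (X → Bool) → Set
      Extreme A = ∀ {B} → Tower B → B ⊆ A → ¬ (A ⊆ B) → f B ⊆ A

      extreme-comparable : ∀ {A B} → Extreme A → Tower B → (B ⊆ A) ⊎ (f A ⊆ B)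
      extreme-comparable {A} exA (step {B} tB) with extreme-comparable exA tB
      ... | inj₂ fA⊆B = inj₂ λ x → inflate B x ∘ fA⊆B x
      ... | inj₁ B⊆A with em {P = A ⊆ B}
      ...   | yes A⊆B = inj₂ λ x → subst (λ C → f C x ≡ true) (⊆-antisym A⊆B B⊆A)
      ...   | no A⊈B = inj₁ (exA tB B⊆A A⊈B)
      extreme-comparable {A} exA (join 𝒞 t𝒞)
        with em {P = ∃[ C ] (𝒞 C ≡ true × f A ⊆ C)}
      ... | yes (C , C∈𝒞 , fA⊆C) = inj₂ λ x → ⊆-⋃ C∈𝒞 x ∘ fA⊆C x
      ... | no none = inj₁ (⋃-⊆ λ C C∈𝒞 → case extreme-comparable exA (t𝒞 C C∈𝒞) of λ where
              (inj₁ C⊆A)  → C⊆A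
              (inj₂ fA⊆C) → contradiction (C , C∈𝒞 , fA⊆C) none)

      -- Induction on `A`, comparing `B` with an earlier member already known to be extreme. At a
      -- union some member `C` is not contained in `B`; comparability then puts `B` strictly below
      -- `C`, hence `f B` inside `C`.
      extreme : ∀ {A} → Tower A → Extreme A
      extreme (step {A} tA) {B} tB B⊆fA fA⊈B with extreme-comparable (extreme tA) tB
      ... | inj₂ fA⊆B = contradiction fA⊆B fA⊈B
      ... | inj₁ B⊆A with em {P = A ⊆ B}
      ...   | yes A⊆B = λ x → subst (λ C → f C x ≡ true) (⊆-antisym B⊆A A⊆B)
      ...   | no A⊈B = λ x → inflate A x ∘ extreme tA tB B⊆A A⊈B x
      extreme (join 𝒞 t𝒞) {B} tB B⊆⋃ ⋃⊈B
        with ¬∀⟶∃¬ {P = λ C → 𝒞 C ≡ true → C ⊆ B} (⋃⊈B ∘ ⋃-⊆)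
      ... | C , ¬h with em {P = 𝒞 C ≡ true}
      ...   | no C∉𝒞 = contradiction (λ C∈𝒞 → contradiction C∈𝒞 C∉𝒞) ¬h
      ...   | yes C∈𝒞 with extreme-comparable (extreme (t𝒞 C C∈𝒞)) tB
      ...     | inj₂ fC⊆B = contradiction (λ _ x → fC⊆B x ∘ inflate C x) ¬h
      ...     | inj₁ B⊆C = λ x → ⊆-⋃ C∈𝒞 x ∘ extreme (t𝒞 C C∈𝒞) tB B⊆C (λ C⊆B → ¬h λ _ → C⊆B) x

      chain : ∀ {A B} → Tower A → Tower B → (A ⊆ B) ⊎ (B ⊆ A)
      chain {A} tA tB with extreme-comparable (extreme tA) tB
      ... | inj₁ B⊆A = inj₂ B⊆A
      ... | inj₂ fA⊆B = inj₁ λ x → fA⊆B x ∘ inflate A x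

    top : X → Bool
    top = ⋃ (λ A → ⌊ Tower A ⌋)

    top∈Tower : Tower top
    top∈Tower = join _ λ A → ⌊⌋-holds

    -- The union of the whole tower is itself a member, so its image under `f` is one of the sets
    -- already united.
    top-closed : f top ⊆ top
    top-closed = ⊆-⋃ (⌊⌋-true (step top∈Tower))

  -- An ultrafilter as a homomorphism of Boolean algebras, or a two-valued integral; iterated
  -- products are then iterated integrals.
  record Ultra (I : Set) : Set where
    field
      ∫      : (I → Bool) → Bool
      ∫-true : ∫ (λ _ → true) ≡ true
      ∫-not  : ∀ p → ∫ (not ∘ p) ≡ not (∫ p)
      ∫-∧    : ∀ p q → ∫ (λ i → p i ∧ q i) ≡ ∫ p ∧ ∫ q

  open Ultra public

  -- A nonprincipal ultrafilter on the natural numbers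

  module FreeUltrafilter where

    _∈ᶠ_ : (ℕ → Bool) → ((ℕ → Bool) → Bool) → Set
    p ∈ᶠ A = A p ≡ true

    -- Common points are required beyond every `n`, not just one; this keeps the resulting
    -- ultrafilter nonprincipal.
    Meets : ((ℕ → Bool) → Bool) → (ℕ → Bool) → Set
    Meets A p = ∀ ps → All (_∈ᶠ A) ps → ∀ n → ∃[ m ] (n ≤ m × p m ≡ true × All (λ q → q m ≡ true) ps)

    Addable : ((ℕ → Bool) → Bool) → Set
    Addable A = ∃[ p ] (A p ≢ true × Meets A p)

    -- The witness stored in the decision acts as the choice of a set to adjoin. Keeping the
    -- decision as an argument lets proofs match on it before excluded middle is supplied.
    add : (A : (ℕ → Bool) → Bool) → Dec (Addable A) → (ℕ → Bool) → Bool
    add A (yes (p , _)) q = A q ∨ ⌊ q ≡ p ⌋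
    add A (no _)          = A

    extend : ((ℕ → Bool) → Bool) → (ℕ → Bool) → Bool
    extend A = add A em

    open Tower extend

    ∨-split : ∀ {x y} → x ∨ y ≡ true → (x ≡ true) ⊎ (y ≡ true)
    ∨-split {true}  _  = inj₁ refl
    ∨-split {false} eq = inj₂ eq

    add-inflate : ∀ A d → A ⊆ add A d
    add-inflate A (yes _) q eq rewrite eq = refl
    add-inflate A (no _)  q eq = eq

    Centred : ((ℕ → Bool) → Bool) → Set
    Centred A = Meets A λ _ → true

    -- Discarding the copies of `p` leaves members of `A`, to which `Meets A p` applies.
    split-list : ∀ A p qs → All (_∈ᶠ (λ q → A q ∨ ⌊ q ≡ p ⌋)) qs →
                 Σ[ rs ∈ List (ℕ → Bool) ] (All (_∈ᶠ A) rs ×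
                   (∀ m → p m ≡ true → All (λ q → q m ≡ true) rs → All (λ q → q m ≡ true) qs))
    split-list A p [] [] = [] , [] , λ _ _ _ → []
    split-list A p (q ∷ qs) (h ∷ hs) with split-list A p qs hs | ∨-split h
    ... | rs , rs∈A , k | inj₁ q∈A = q ∷ rs , q∈A ∷ rs∈A , λ { m pm (qm ∷ rsm) → qm ∷ k m pm rsm }
    ... | rs , rs∈A , k | inj₂ q≡p = rs , rs∈A , λ m pm rsm →
          subst (λ r → r m ≡ true) (sym (⌊⌋-holds q≡p)) pm ∷ k m pm rsm

    add-centred : ∀ A d → Centred A → Centred (add A d)
    add-centred A (no _) cA = cA
    add-centred A (yes (p , _ , meets)) cA qs qs∈ n =
      let rs , rs∈A , k = split-list A p qs qs∈
          m , n≤m , pm , rsm = meets rs rs∈A n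
      in m , n≤m , refl , k m pm rsm

    -- A finite part of a union of a chain already lies in one of its members.
    finite-part : ∀ 𝒞 → (∀ A → 𝒞 A ≡ true → Tower A) → ∀ p ps → All (_∈ᶠ ⋃ 𝒞) (p ∷ ps) →
                  ∃[ A ] (𝒞 A ≡ true × All (_∈ᶠ A) (p ∷ ps))
    finite-part 𝒞 t𝒞 p [] (h ∷ []) = let A , A∈𝒞 , p∈A = ⌊⌋-holds h in A , A∈𝒞 , p∈A ∷ []
    finite-part 𝒞 t𝒞 p (p′ ∷ ps) (h ∷ hs)
      with ⌊⌋-holds h | finite-part 𝒞 t𝒞 p′ ps hs
    ... | A , A∈𝒞 , p∈A | B , B∈𝒞 , ps∈B
      with chain (λ C → add-inflate C em) (t𝒞 A A∈𝒞) (t𝒞 B B∈𝒞)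
    ... | inj₁ A⊆B = B , B∈𝒞 , A⊆B p p∈A ∷ ps∈B
    ... | inj₂ B⊆A = A , A∈𝒞 , p∈A ∷ All.map (λ {q} → B⊆A q) ps∈B

    tower-centred : ∀ {A} → Tower A → Centred A
    tower-centred (step {A} tA) = add-centred A em (tower-centred tA)
    tower-centred (join 𝒞 t𝒞) [] _ n = n , ≤-refl , refl , []
    tower-centred (join 𝒞 t𝒞) (p ∷ ps) ps∈ n =
      let A , A∈𝒞 , ps∈A = finite-part 𝒞 t𝒞 p ps ps∈
      in tower-centred (t𝒞 A A∈𝒞) (p ∷ ps) ps∈A n

    top-centred : Centred top
    top-centred = tower-centred top∈Tower

    add-closed⇒maximal : ∀ A d → add A d ⊆ A → ∀ p → Meets A p → p ∈ᶠ A
    add-closed⇒maximal A (yes (p , p∉A , _)) closed q _ =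
      contradiction (closed p (trans (cong (A p ∨_) (⌊⌋-true refl)) (∨-zeroʳ (A p)))) p∉A
    add-closed⇒maximal A (no none) _ q meets = stable λ q∉A → none (q , q∉A , meets)

    maximal : ∀ p → Meets top p → p ∈ᶠ top
    maximal = add-closed⇒maximal top em top-closed

    -- Centredness supplies common points as large as desired, in particular beyond `n`, where `p`
    -- holds.
    cofinite : ∀ n p → (∀ m → n ≤ m → p m ≡ true) → p ∈ᶠ top
    cofinite n p h = maximal p λ ps ps∈ k →
      let m , le , _ , psm = top-centred ps ps∈ (n ⊔ k)
      in m , ≤-trans (m≤n⊔m n k) le , h m (≤-trans (m≤m⊔n n k) le) , psm

    ∧-intro : ∀ {x y} → x ≡ true → y ≡ true → x ∧ y ≡ true
    ∧-intro refl refl = refl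

    ∧-left : ∀ {x y} → x ∧ y ≡ true → x ≡ true
    ∧-left {true} _ = refl

    ∧-right : ∀ {x y} → x ∧ y ≡ true → y ≡ true
    ∧-right {true} eq = eq

    upward : ∀ p q → (∀ m → p m ≡ true → q m ≡ true) → p ∈ᶠ top → q ∈ᶠ top
    upward p q h p∈ = maximal q λ ps ps∈ k → case top-centred (p ∷ ps) (p∈ ∷ ps∈) k of λ where
      (m , k≤m , _ , pm ∷ psm) → m , k≤m , h m pm , psm

    meet : ∀ p q → p ∈ᶠ top → q ∈ᶠ top → (λ m → p m ∧ q m) ∈ᶠ top
    meet p q p∈ q∈ = maximal _ λ ps ps∈ k → case top-centred (p ∷ q ∷ ps) (p∈ ∷ q∈ ∷ ps∈) k of λ where
      (m , k≤m , _ , pm ∷ qm ∷ psm) → m , k≤m , ∧-intro pm qm , psm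

    not-both : ∀ p → p ∈ᶠ top → ¬ ((not ∘ p) ∈ᶠ top)
    not-both p p∈ np∈ with top-centred (p ∷ (not ∘ p) ∷ []) (p∈ ∷ np∈ ∷ []) 0
    ... | m , _ , _ , pm ∷ npm ∷ [] = case trans (sym (cong not pm)) npm of λ ()

    -- If neither p nor its complement can be added, the two finite
    -- obstructions together contradict the centredness of top.
    either : ∀ p → ¬ (p ∈ᶠ top) → (not ∘ p) ∈ᶠ top
    either p p∉ = maximal (not ∘ p) λ ps ps∈ n → stable λ none → p∉ (maximal p λ qs qs∈ k →
      let m , le , _ , both = top-centred (ps List.++ qs) (Allₚ.++⁺ ps∈ qs∈) (n ⊔ k)
          psm , qsm = Allₚ.++⁻ ps both
      in m , ≤-trans (m≤n⊔m n k) le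
           , stable (λ ¬pm → none (m , ≤-trans (m≤m⊔n n k) le , not-true ¬pm , psm))
           , qsm)
      where
      not-true : ∀ {x} → ¬ (x ≡ true) → not x ≡ true
      not-true {true}  h = contradiction refl h
      not-true {false} _ = refl

    not-iff : ∀ {x y} → ¬ (x ≡ true × y ≡ true) → (¬ (x ≡ true) → y ≡ true) → y ≡ not x
    not-iff {true}  {true}  h _ = contradiction (refl , refl) h
    not-iff {true}  {false} _ _ = refl
    not-iff {false}         _ k = k λ ()

    free : Ultra ℕ
    free = record
      { ∫      = top
      ; ∫-true = cofinite 0 _ λ _ _ → refl
      ; ∫-not  = λ p → not-iff (λ (p∈ , np∈) → not-both p p∈ np∈) (either p)
      ; ∫-∧    = λ p q → true-iff
          (λ pq∈ → ∧-intro (upward _ p (λ _ → ∧-left) pq∈) (upward _ q (λ m → ∧-right {p m}) pq∈))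
          (λ eq → meet p q (∧-left eq) (∧-right {top p} eq))
      }

  open FreeUltrafilter public using (free; cofinite)

  -- Iterated integrals and statements that hold almost everywhere

  point : I → Ultra I
  point i = record { ∫ = λ p → p i ; ∫-true = refl ; ∫-not = λ _ → refl ; ∫-∧ = λ _ _ → refl }

  infixl 1 _>>=_
  _>>=_ : Ultra I → (I → Ultra I′) → Ultra I′
  U >>= V = record
    { ∫      = λ p → ∫ U λ i → ∫ (V i) p
    ; ∫-true = trans (cong (∫ U) (fe λ i → ∫-true (V i))) (∫-true U)
    ; ∫-not  = λ p → trans (cong (∫ U) (fe λ i → ∫-not (V i) p)) (∫-not U _)
    ; ∫-∧    = λ p q → trans (cong (∫ U) (fe λ i → ∫-∧ (V i) p q)) (∫-∧ U _ _)
    }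

  ∫-const : (U : Ultra I) (x : Bool) → ∫ U (λ _ → x) ≡ x
  ∫-const U true  = ∫-true U
  ∫-const U false = trans (∫-not U (λ _ → true)) (cong not (∫-true U))

  ∫-mono₂ : (U : Ultra I) {p q r : I → Bool} →
            (∀ i → p i ≡ true → q i ≡ true → r i ≡ true) →
            ∫ U p ≡ true → ∫ U q ≡ true → ∫ U r ≡ true
  ∫-mono₂ U {p} {q} {r} h up uq = begin
    ∫ U r                                 ≡⟨ cong₂ (λ x y → x ∧ y ∧ ∫ U r) up uq ⟨
    ∫ U p ∧ ∫ U q ∧ ∫ U r                 ≡⟨ cong (∫ U p ∧_) (∫-∧ U q r) ⟨
    ∫ U p ∧ ∫ U (λ i → q i ∧ r i)         ≡⟨ ∫-∧ U p _ ⟨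
    ∫ U (λ i → p i ∧ q i ∧ r i)           ≡⟨ cong (∫ U) (fe λ i → absorb (h i)) ⟩
    ∫ U (λ i → p i ∧ q i)                 ≡⟨ ∫-∧ U p q ⟩
    ∫ U p ∧ ∫ U q                         ≡⟨ cong₂ _∧_ up uq ⟩
    true                                  ∎
    where
    open ≡-Reasoning
    absorb : ∀ {x y z} → (x ≡ true → y ≡ true → z ≡ true) → x ∧ y ∧ z ≡ x ∧ y
    absorb {true}  {true}  h = h refl refl
    absorb {true}  {false} h = refl
    absorb {false}         h = refl

  -- Although the integral is a Boolean equation, the record sits at the level of `P`, so that it
  -- can interpret the relation symbols of the limit power.
  record Almost (U : Ultra I) (P : I → Set a) : Set a where
    constructor almost
    field
      integral : ∫ U (λ i → ⌊ P i ⌋) ≡ true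

  open Almost

  module _ {U : Ultra I} where

    almost-all : {P : I → Set a} → (∀ i → P i) → Almost U P
    almost-all h = almost (trans (cong (∫ U) (fe λ i → ⌊⌋-true (h i))) (∫-true U))

    almost-map₂ : {P : I → Set a} {Q : I → Set b} {R : I → Set c} →
                  (∀ i → P i → Q i → R i) → Almost U P → Almost U Q → Almost U R
    almost-map₂ h p q = almost (∫-mono₂ U (λ i x y → ⌊⌋-true (h i (⌊⌋-holds x) (⌊⌋-holds y)))
                                          (integral p) (integral q))

    almost-map : {P : I → Set a} {Q : I → Set b} →
                 (∀ i → P i → Q i) → Almost U P → Almost U Q
    almost-map h p = almost-map₂ (λ i x _ → h i x) p p

    almost-¬ : {P : I → Set a} → ¬ Almost U P → Almost U (λ i → ¬ P i)
    almost-¬ {P = P} h with ∫ U (λ i → ⌊ P i ⌋) in eq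
    ... | true  = contradiction (almost eq) h
    ... | false = almost (trans (cong (∫ U) (fe λ i → ⌊⌋-not)) (trans (∫-not U _) (cong not eq)))

    almost-exists : {P : I → Set a} → Almost U P → ∃[ i ] P i
    almost-exists {P = P} h = stable λ none →
      case trans (sym (integral h))
             (trans (cong (∫ U) (fe λ i → false-if (λ p → none (i , p)))) (∫-const U false)) of λ ()
      where
      false-if : {Q : Set a} → ¬ Q → ⌊ Q ⌋ ≡ false
      false-if ¬q = true-iff (λ eq → contradiction (⌊⌋-holds eq) ¬q) λ ()

    almost-⇒ : {P : I → Set a} {Q : I → Set b} →
               (Almost U P → Almost U Q) → Almost U (λ i → P i → Q i)
    almost-⇒ {P = P} h with em {P = Almost U P}
    ... | yes p = almost-map (λ i q _ → q) (h p)
    ... | no ¬p = almost-map (λ i np p → contradiction p np) (almost-¬ ¬p)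

  almost-point : {i : I} {P : I → Set a} → P i → Almost (point i) P
  almost-point p = almost (⌊⌋-true p)

  almost->>= : {U : Ultra I} {V : I → Ultra I′} {P : I′ → Set a} →
               Almost U (λ i → Almost (V i) P) → Almost (U >>= V) P
  almost->>= {U = U} h = almost (trans
    (cong (∫ U) (fe λ i → true-iff (⌊⌋-true ∘ almost) (integral ∘ ⌊⌋-holds))) (integral h))

  eventually : {P : ℕ → Set a} (n : ℕ) → (∀ m → n ≤ m → P m) → Almost free P
  eventually n h = almost (cofinite n _ λ m n≤m → ⌊⌋-true (h m n≤m))

  -- Iterated products along windows of integers

  Seq : Set
  Seq = ℤ → ℕ

  _[_≔_] : Seq → ℤ → ℕ → Seq
  (x [ i ≔ v ]) j = if does (j ℤ.≟ i) then v else x j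

  ≔-same : ∀ x i v → (x [ i ≔ v ]) i ≡ v
  ≔-same x i v with i ℤ.≟ i
  ... | yes _ = refl
  ... | no i≢i = contradiction refl i≢i

  ≔-other : ∀ x i v j → j ≢ i → (x [ i ≔ v ]) j ≡ x j
  ≔-other x i v j j≢i with j ℤ.≟ i
  ... | yes j≡i = contradiction j≡i j≢i
  ... | no _ = refl

  -- The iterated product of the free ultrafilter along the coordinates
  -- i, …, i + n - 1, the leftmost being the outermost quantifier.
  window : ℤ → ℕ → Seq → Ultra Seq
  window i zero    x = point x
  window i (suc n) x = free >>= λ v → window (ℤ.suc i) n (x [ i ≔ v ])

  _SupportedIn_ : {A : Set a} → (Seq → A) → (ℤ → Set) → Set a
  p SupportedIn S = ∀ {x y} → (∀ i → S i → x i ≡ y i) → p x ≡ p y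

  window-agree : ∀ {S} {p : Seq → Bool} → p SupportedIn S → ∀ i n {x y} → (∀ j → S j → x j ≡ y j) →
                 ∫ (window i n x) p ≡ ∫ (window i n y) p
  window-agree supp i zero    x≈y = supp x≈y
  window-agree supp i (suc n) {x} {y} x≈y = cong (∫ free) (fe λ v → window-agree supp (ℤ.suc i) n (agree v))
    where
    agree : ∀ v j → _ → (x [ i ≔ v ]) j ≡ (y [ i ≔ v ]) j
    agree v j Sj with does (j ℤ.≟ i)
    ... | true  = refl
    ... | false = x≈y j Sj

  ≔-agree : ∀ {S : ℤ → Set} x i v → ¬ S i → ∀ j → S j → (x [ i ≔ v ]) j ≡ x j
  ≔-agree x i v ¬Si j Sj = ≔-other x i v j λ { refl → ¬Si Sj }

  -- The outermost quantifier binds a coordinate that `p` ignores, so the inner integral is constant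
  -- in `v`.
  drop-first : ∀ {S} {p : Seq → Bool} → p SupportedIn S → ∀ i n x → ¬ S i →
               ∫ (window i (suc n) x) p ≡ ∫ (window (ℤ.suc i) n x) p
  drop-first {S} supp i n x ¬Si = trans
    (cong (∫ free) (fe λ v → window-agree supp (ℤ.suc i) n (≔-agree {S} x i v ¬Si)))
    (∫-const free _)

  suc-+ : ∀ i n → ℤ.suc i ℤ.+ (+ n) ≡ i ℤ.+ (+ suc n)
  suc-+ i n = begin
    ℤ.1ℤ ℤ.+ i ℤ.+ (+ n)     ≡⟨ cong (ℤ._+ (+ n)) (ℤₚ.+-comm ℤ.1ℤ i) ⟩
    i ℤ.+ ℤ.1ℤ ℤ.+ (+ n)     ≡⟨ ℤₚ.+-assoc i ℤ.1ℤ (+ n) ⟩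
    i ℤ.+ (+ suc n)          ∎
    where open ≡-Reasoning

  drop-last : ∀ {S} {p : Seq → Bool} → p SupportedIn S → ∀ i n x → ¬ S (i ℤ.+ (+ n)) →
              ∫ (window i (suc n) x) p ≡ ∫ (window i n x) p
  drop-last {S} supp i zero x ¬Si = drop-first {S} supp i zero x (subst (¬_ ∘ S) (ℤₚ.+-identityʳ i) ¬Si)
  drop-last {S} supp i (suc n) x ¬Sl = cong (∫ free) (fe λ v →
    drop-last {S} supp (ℤ.suc i) n (x [ i ≔ v ]) (subst (¬_ ∘ S) (sym (suc-+ i n)) ¬Sl))

  translate : ℤ → Seq → Seq
  translate n x i = x (n ℤ.+ i)

  shift : Seq → Seq
  shift = translate ℤ.1ℤ

  translate-0 : ∀ x → translate ℤ.0ℤ x ≡ x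
  translate-0 x = fe λ i → cong x (ℤₚ.+-identityˡ i)

  translate-translate : ∀ m n x → translate m (translate n x) ≡ translate (n ℤ.+ m) x
  translate-translate m n x = fe λ i → cong x (sym (ℤₚ.+-assoc n m i))

  shift-≔ : ∀ x i v → shift (x [ ℤ.suc i ≔ v ]) ≡ shift x [ i ≔ v ]
  shift-≔ x i v = fe λ j → agree j
    where
    agree : ∀ j → shift (x [ ℤ.suc i ≔ v ]) j ≡ (shift x [ i ≔ v ]) j
    agree j with j ℤ.≟ i
    ... | yes refl = ≔-same x (ℤ.suc i) v
    ... | no j≢i = ≔-other x (ℤ.suc i) v (ℤ.suc j) λ eq → 
          j≢i (trans (sym (ℤₚ.pred-suc j)) (trans (cong ℤ.pred eq) (ℤₚ.pred-suc i)))

  window-shift : ∀ p i n x → ∫ (window (ℤ.suc i) n x) (p ∘ shift) ≡ ∫ (window i n (shift x)) p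
  window-shift p i zero    x = refl
  window-shift p i (suc n) x = cong (∫ free) (fe λ v → trans
    (window-shift p (ℤ.suc i) n (x [ ℤ.suc i ≔ v ]))
    (cong (λ y → ∫ (window (ℤ.suc i) n y) p) (shift-≔ x i v)))

  Within : ℕ → ℤ → Set
  Within s i = ∣ i ∣ ≤ s

  centred : ℕ → Ultra Seq
  centred N = window (ℤ.- (+ N)) (suc (N + N)) (λ _ → 0)

  +-within : ∀ {s} n i → Within s i → Within (∣ n ∣ + s) (n ℤ.+ i)
  +-within n i h = ≤-trans (ℤₚ.∣i+j∣≤∣i∣+∣j∣ n i) (ℕₚ.+-monoʳ-≤ ∣ n ∣ h)

  SupportedIn-translate : ∀ {A : Set a} {s} {p : Seq → A} n → p SupportedIn Within s →
                          (p ∘ translate n) SupportedIn Within (∣ n ∣ + s)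
  SupportedIn-translate n supp agree = supp λ i wi → agree (n ℤ.+ i) (+-within n i wi)

  -- The shift moves the window from -N, ..., N to -N+1, ..., N+1. The two differ only in the
  -- coordinates -N and N+1, both outside the support of `p ∘ shift`, so one may be dropped and the
  -- other added.
  centred-shift : ∀ {s} {p : Seq → Bool} → p SupportedIn Within s → ∀ N → suc s < N →
                  ∫ (centred N) (p ∘ shift) ≡ ∫ (centred N) p
  centred-shift {s} {p} supp N s<N = begin
    ∫ (window lo (suc (N + N)) zeros) (p ∘ shift)          ≡⟨ drop-first supp′ lo (N + N) zeros lo∉ ⟩
    ∫ (window (ℤ.suc lo) (N + N) zeros) (p ∘ shift)        ≡⟨ drop-last supp′ (ℤ.suc lo) (N + N) zeros hi∉ ⟨
    ∫ (window (ℤ.suc lo) (suc (N + N)) zeros) (p ∘ shift)  ≡⟨ window-shift p lo (suc (N + N)) zeros ⟩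
    ∫ (window lo (suc (N + N)) zeros) p                    ∎
    where
    open ≡-Reasoning
    lo = ℤ.- (+ N)
    zeros : Seq
    zeros _ = 0
    supp′ : (p ∘ shift) SupportedIn Within (suc s)
    supp′ = SupportedIn-translate ℤ.1ℤ supp
    lo∉ : ¬ Within (suc s) lo
    lo∉ w = ℕₚ.<⇒≱ s<N (subst (_≤ suc s) (ℤₚ.∣-i∣≡∣i∣ (+ N)) w)
    hi≡ : ℤ.suc lo ℤ.+ (+ (N + N)) ≡ + suc N
    hi≡ = begin
      ℤ.suc lo ℤ.+ (+ (N + N))       ≡⟨ ℤₚ.+-assoc ℤ.1ℤ lo _ ⟩
      ℤ.suc (lo ℤ.+ (+ N ℤ.+ + N))     ≡⟨ cong ℤ.suc (ℤₚ.+-assoc lo (+ N) (+ N)) ⟨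
      ℤ.suc (lo ℤ.+ + N ℤ.+ + N)       ≡⟨ cong (λ z → ℤ.suc (z ℤ.+ + N)) (ℤₚ.+-inverseˡ (+ N)) ⟩
      ℤ.suc (ℤ.0ℤ ℤ.+ + N)             ≡⟨⟩
      + suc N                          ∎
    hi∉ : ¬ Within (suc s) (ℤ.suc lo ℤ.+ (+ (N + N)))
    hi∉ w = ℕₚ.<⇒≱ s<N (≤-trans (ℕₚ.n≤1+n N) (subst (Within (suc s)) hi≡ w))

  record Increasing (i j : ℤ) (low : ℕ) (x : Seq) : Set where
    field
      bounded : ∀ k → i ℤ.≤ k → k ℤ.< j → low ≤ x k
      strict  : ∀ k l → i ℤ.≤ k → k ℤ.< l → l ℤ.< j → x k < x l

  ≤-case : ∀ {i k} → i ℤ.≤ k → (i ≡ k) ⊎ (ℤ.suc i ℤ.≤ k)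
  ≤-case {i} {k} i≤k with i ℤ.≟ k
  ... | yes eq = inj₁ eq
  ... | no neq = inj₂ (ℤₚ.i<j⇒suc[i]≤j (ℤₚ.≤∧≢⇒< i≤k neq))

  -- Each new coordinate avoids an initial segment of ℕ, so almost every
  -- sequence is increasing on the window.
  window-increasing : ∀ i n x low → Almost (window i n x) λ y →
                      (∀ k → k ℤ.< i → y k ≡ x k) × Increasing i (i ℤ.+ (+ n)) low y
  window-increasing i zero x low = almost-point ((λ _ _ → refl) , record
    { bounded = λ k i≤k k<i → contradiction (subst (k ℤ.<_) (ℤₚ.+-identityʳ i) k<i) (ℤₚ.≤⇒≯ i≤k)
    ; strict  = λ k l i≤k k<l l<i → contradiction (subst (l ℤ.<_) (ℤₚ.+-identityʳ i) l<i)
                  (ℤₚ.≤⇒≯ (ℤₚ.≤-trans i≤k (ℤₚ.<⇒≤ k<l))) })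
  -- Passing `suc v` on as the lower bound turns `bounded` for the inner window into strictness
  -- against coordinate `i`. The clause on earlier coordinates is carried along to know that `y i`
  -- is still `v`.
  window-increasing i (suc n) x low = almost->>= (eventually low λ v low≤v →
    almost-map (λ y → extend v low≤v y)
      (window-increasing (ℤ.suc i) n (x [ i ≔ v ]) (suc v)))
    where
    extend : ∀ v → low ≤ v → ∀ y →
             (∀ k → k ℤ.< ℤ.suc i → y k ≡ (x [ i ≔ v ]) k) × Increasing (ℤ.suc i) (ℤ.suc i ℤ.+ (+ n)) (suc v) y →
             (∀ k → k ℤ.< i → y k ≡ x k) × Increasing i (i ℤ.+ (+ suc n)) low y
    extend v low≤v y (before , inc) rewrite suc-+ i n =
      (λ k k<i → trans (before k (ℤₚ.<-trans k<i i<suc)) (≔-other x i v k (ℤₚ.<⇒≢ k<i))) ,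
      record { bounded = bd ; strict = st }
      where
      open Increasing inc
      i<suc : i ℤ.< ℤ.suc i
      i<suc = ℤₚ.suc[i]≤j⇒i<j ℤₚ.≤-refl
      yi : y i ≡ v
      yi = trans (before i i<suc) (≔-same x i v)
      bd : ∀ k → i ℤ.≤ k → k ℤ.< i ℤ.+ (+ suc n) → low ≤ y k
      bd k i≤k k<j with ≤-case i≤k
      ... | inj₁ refl = subst (low ≤_) (sym yi) low≤v
      ... | inj₂ i<k = ≤-trans (ℕₚ.m≤n⇒m≤1+n low≤v) (bounded k i<k k<j)
      st : ∀ k l → i ℤ.≤ k → k ℤ.< l → l ℤ.< i ℤ.+ (+ suc n) → y k < y l
      st k l i≤k k<l l<j with ≤-case i≤k
      ... | inj₁ refl = subst (_< y l) (sym yi) (bounded l (ℤₚ.i<j⇒suc[i]≤j k<l) l<j)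
      ... | inj₂ i<k = strict k l i<k k<l l<j

  InjectiveWithin : ℕ → Seq → Set
  InjectiveWithin s x = ∀ i j → Within s i → Within s j → x i ≡ x j → i ≡ j

  within-≥ : ∀ {s} i → Within s i → ℤ.- (+ s) ℤ.≤ i
  within-≥ {zero}  (+ n)     w = ℤ.+≤+ ℕ.z≤n
  within-≥ {suc s} (+ n)     w = ℤ.-≤+
  within-≥ {suc s} -[1+ n ] (s≤s w) = ℤ.-≤- w

  within-≤ : ∀ {s} i → Within s i → i ℤ.≤ + s
  within-≤ (+ n)     w = ℤ.+≤+ w
  within-≤ -[1+ n ]  w = ℤ.-≤+

  centred-injective : ∀ N s → s ≤ N → Almost (centred N) (InjectiveWithin s)
  centred-injective N s s≤N = almost-map (λ x (_ , inc) → injective x inc)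
    (window-increasing lo (suc (N + N)) (λ _ → 0) 0)
    where
    lo = ℤ.- (+ N)
    hi = lo ℤ.+ (+ suc (N + N))
    hi≡ : hi ≡ + suc N
    hi≡ = begin
      lo ℤ.+ (+ suc (N + N))         ≡⟨ cong (λ n → lo ℤ.+ (+ n)) (ℕₚ.+-suc N N) ⟨
      lo ℤ.+ (+ N ℤ.+ + suc N)         ≡⟨ ℤₚ.+-assoc lo (+ N) (+ suc N) ⟨
      lo ℤ.+ + N ℤ.+ + suc N           ≡⟨ cong (ℤ._+ + suc N) (ℤₚ.+-inverseˡ (+ N)) ⟩
      ℤ.0ℤ ℤ.+ + suc N                 ≡⟨⟩
      + suc N                          ∎
      where open ≡-Reasoning
    ≥lo : ∀ i → Within s i → lo ℤ.≤ i
    ≥lo i w = within-≥ i (≤-trans w s≤N)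
    <hi : ∀ i → Within s i → i ℤ.< hi
    <hi i w = subst (i ℤ.<_) (sym hi≡) (ℤₚ.≤-<-trans (within-≤ i (≤-trans w s≤N)) (ℤ.+<+ ≤-refl))
    injective : ∀ x → Increasing lo hi 0 x → InjectiveWithin s x
    injective x inc i j wi wj eq with ℤₚ.<-cmp i j
    ... | tri< i<j _ _ = contradiction eq (ℕₚ.<⇒≢ (Increasing.strict inc i j (≥lo i wi) i<j (<hi j wj)))
    ... | tri≈ _ i≡j _ = i≡j
    ... | tri> _ _ j<i = contradiction (sym eq) (ℕₚ.<⇒≢ (Increasing.strict inc j i (≥lo j wj) j<i (<hi i wi)))

  bounded-within : ∀ (x : Seq) s → ∃[ n ] (∀ i → Within s i → x i < n)
  bounded-within x zero = suc (x ℤ.0ℤ) , λ { (+ zero) _ → ≤-refl }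
  bounded-within x (suc s) with bounded-within x s
  ... | n , below = bound , within-bound
    where
    bound = n ⊔ (suc (x (+ suc s)) ⊔ suc (x -[1+ s ]))
    within-bound : ∀ i → Within (suc s) i → x i < bound
    within-bound i w with ℕₚ.m≤n⇒m<n∨m≡n w
    within-bound i w | inj₁ (s≤s w′) = ≤-trans (below i w′) (m≤m⊔n n _)
    within-bound (+ _) w | inj₂ refl = ≤-trans (m≤m⊔n _ (suc (x -[1+ s ]))) (m≤n⊔m n _)
    within-bound -[1+ _ ] w | inj₂ refl = ≤-trans (m≤n⊔m (suc (x (+ suc s))) _) (m≤n⊔m n _)

  -- The limit ultrafilter and its shift invariance

  Index : Set
  Index = ℕ × Seq × ℕ

  -- The order matters: the support may depend on `k`, the window size `N` must exceed the support,
  -- and `m` must exceed the relevant values of `x`. Integrating over `N` as well expresses "for all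
  -- large windows" by an ultrafilter.
  limit : Ultra Index
  limit = free >>= λ k → free >>= λ N → centred N >>= λ x → free >>= λ m → point (k , x , m)

  almost-limit : {P : Index → Set a} →
    Almost free (λ k → ∃[ s ] (∀ x → InjectiveWithin s x → ∃[ n ] (∀ m → n ≤ m → P (k , x , m)))) →
    Almost limit P
  almost-limit {P = P} h = almost->>= (almost-map (λ k (s , g) →
    almost->>= (eventually s λ N s≤N → almost->>= (almost-map
      (λ x inj → let n , l = g x inj in almost->>= (eventually n λ m n≤m → almost-point (l m n≤m)))
      (centred-injective N s s≤N)))) h)

  -- The bound may grow with `k`, so that ever longer parts of a sequence can be realized, but is
  -- uniform in `m`, so that integrating over `m` preserves the support.
  FinitelySupported : {A : Set a} → (Index → A) → Set a
  FinitelySupported f = ∀ k → ∃[ s ] (∀ m → (λ x → f (k , x , m)) SupportedIn Within s)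

  translateᴵ : ℤ → Index → Index
  translateᴵ n (k , x , m) = k , translate n x , m

  -- For fixed `k`, integrating out `m` leaves a predicate of `x` with bounded support;
  -- `centred-shift` then applies to all large `N`.
  limit-shift : {p : Index → Bool} → FinitelySupported p → ∫ limit (p ∘ translateᴵ ℤ.1ℤ) ≡ ∫ limit p
  limit-shift {p} fs = cong (∫ free) (fe λ k → let s , supp = fs k in
    ∫-cong-eventually (suc (suc s)) λ N s<N → centred-shift (λ {x} {y} agree →
      cong (∫ free) (fe λ m → supp m agree)) N s<N)
    where
    ∫-cong-eventually : ∀ n {f g : ℕ → Bool} → (∀ m → n ≤ m → f m ≡ g m) → ∫ free f ≡ ∫ free g
    ∫-cong-eventually n {f} {g} h = true-iff
      (λ eq → ∫-mono₂ free (λ m fm le → trans (sym (h m (⌊⌋-holds le))) fm) eq (integral (eventually n λ _ le → le)))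
      (λ eq → ∫-mono₂ free (λ m gm le → trans (h m (⌊⌋-holds le)) gm) eq (integral (eventually n λ _ le → le)))

  almost-shift : {A : Set a} (R : A → Set b) (f : Index → A) → FinitelySupported f →
    Almost limit (λ i → R (f i)) ⇔ Almost limit (λ i → R (f (translateᴵ ℤ.1ℤ i)))
  almost-shift R f supp = mk⇔ (λ h → almost (trans invariant (integral h))) (λ h → almost (trans (sym invariant) (integral h)))
    where
    invariant : ∫ limit (λ i → ⌊ R (f (translateᴵ ℤ.1ℤ i)) ⌋) ≡ ∫ limit (λ i → ⌊ R (f i) ⌋)
    invariant = limit-shift {p = λ i → ⌊ R (f i) ⌋} λ k →
      let s , eq = supp k in s , λ m agree → cong (λ z → ⌊ R z ⌋) (eq m agree)

-- The limit ultrapower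

  -- A chosen representative depends only on the Boolean-valued class of an
  -- element, so equivalent elements get equal representatives.
  module Quotient {A : Set a} (_~_ : A → A → Set b) (~-refl : ∀ {x} → x ~ x)
                  (~-sym : ∀ {x y} → x ~ y → y ~ x) (~-trans : ∀ {x y z} → x ~ y → y ~ z → x ~ z) where

    class : A → A → Bool
    class x y = ⌊ x ~ y ⌋

    class-cong : ∀ {x y} → x ~ y → class x ≡ class y
    class-cong x~y = fe λ z → ⌊⌋-cong (~-trans (~-sym x~y)) (~-trans x~y)

    pick : (C : A → Bool) → Dec (∃[ y ] C y ≡ true) → A → A
    pick C (yes (y , _)) _ = y
    pick C (no _)        x = x

    pick-∈ : ∀ (C : A → Bool) d x → C x ≡ true → C (pick C d x) ≡ true
    pick-∈ C (yes (_ , Cy)) x _  = Cy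
    pick-∈ C (no _)         x Cx = Cx

    pick-cong : ∀ (C : A → Bool) d {x y} → C x ≡ true → pick C d x ≡ pick C d y
    pick-cong C (yes _)   _  = refl
    pick-cong C (no none) Cx = contradiction (_ , Cx) none

    abstract
      canon : A → A
      canon x = pick (class x) em x

      canon-~ : ∀ x → x ~ canon x
      canon-~ x = ⌊⌋-holds (pick-∈ (class x) em x (⌊⌋-true ~-refl))

      canon-cong : ∀ {x y} → x ~ y → canon x ≡ canon y
      canon-cong {x} {y} x~y = trans (pick-cong (class x) em (⌊⌋-true ~-refl))
        (cong (λ C → pick C em y) (class-cong x~y))

    _/~ : Set _
    _/~ = Σ[ x ∈ A ] canon x ≡ x

    rep : _/~ → A
    rep = proj₁

    [_] : A → _/~
    [ x ] = canon x , sym (canon-cong (canon-~ x))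

    rep-[] : ∀ x → rep [ x ] ~ x
    rep-[] x = ~-sym (canon-~ x)

    rep-injective : ∀ {c d} → rep c ≡ rep d → c ≡ d
    rep-injective {x , p} {.x , q} refl = cong (x ,_) (uip p q)

    []-cong : ∀ {x y} → x ~ y → [ x ] ≡ [ y ]
    []-cong x~y = rep-injective (canon-cong x~y)

    []-rep : ∀ c → [ rep c ] ≡ c
    []-rep (x , p) = rep-injective p

    rep-~ : ∀ {c d} → rep c ~ rep d → c ≡ d
    rep-~ {c} {d} h = trans (sym ([]-rep c)) (trans ([]-cong h) ([]-rep d))

  module LimitPower {ℓ} {L : Language ℓ} (M : Structure L) where

    -- Finite support makes translation respect almost-everywhere equality, and it survives all
    -- pointwise operations of `M`.
    Element : Set ℓ
    Element = Σ[ f ∈ (Index → Carrier M) ] FinitelySupported f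

    _at_ : Element → Index → Carrier M
    (f , _) at i = f i

    record _~_ (e f : Element) : Set ℓ where
      constructor agreeing
      field
        agree : Almost limit λ i → e at i ≡ f at i

    open _~_

    ~-refl : ∀ {e} → e ~ e
    ~-refl = agreeing (almost-all λ _ → refl)

    ~-sym : ∀ {e f} → e ~ f → f ~ e
    ~-sym e~f = agreeing (almost-map (λ _ → sym) (agree e~f))

    ~-trans : ∀ {e f g} → e ~ f → f ~ g → e ~ g
    ~-trans e~f f~g = agreeing (almost-map₂ (λ _ → trans) (agree e~f) (agree f~g))

    open Quotient _~_ ~-refl ~-sym ~-trans renaming ([_] to [_]ᴱ) public

    val : Index → _/~ → Carrier M
    val i c = rep c at i

    vals : ∀ {n} → Index → Vec _/~ n → Vec (Carrier M) n
    vals i = map (val i)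

    supported-∘ : ∀ {A : Set a} {B : Set b} (h : A → B) {f : Index → A} → FinitelySupported f → FinitelySupported (h ∘ f)
    supported-∘ h supp k = let s , eq = supp k in s , λ m agree → cong h (eq m agree)

    supported-∷ : ∀ {A : Set a} {n} {f : Index → A} {g : Index → Vec A n} →
                  FinitelySupported f → FinitelySupported g → FinitelySupported (λ i → f i ∷ g i)
    supported-∷ fs gs k =
      let s , feq = fs k
          t , geq = gs k
      in s ⊔ t , λ m agree → cong₂ Vec._∷_ (feq m λ i w → agree i (≤-trans w (m≤m⊔n s t)))
                                       (geq m λ i w → agree i (≤-trans w (m≤n⊔m s t)))

    supported-vals : ∀ {n} (v : Vec _/~ n) → FinitelySupported (λ i → vals i v)
    supported-vals []       k = 0 , λ _ _ → refl
    supported-vals (c ∷ v) = supported-∷ (proj₂ (rep c)) (supported-vals v)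

    apply : ∀ {n} → (Vec (Carrier M) n → Carrier M) → Vec _/~ n → Element
    apply h v = (λ i → h (vals i v)) , supported-∘ h (supported-vals v)

    power-structure : Structure L
    power-structure = record
      { Carrier   = _/~
      ; inhabited = [ (λ _ → inhabited M) , (λ k → 0 , λ _ _ → refl) ]ᴱ
      ; funᴹ      = λ g v → [ apply (funᴹ M g) v ]ᴱ
      ; relᴹ      = λ r v → Almost limit λ i → relᴹ M r (vals i v)
      }

    mutual
      eval-vals : ∀ {n} (v : Vec _/~ n) t →
                  Almost limit λ i → val i (eval power-structure v t) ≡ eval M (vals i v) t
      eval-vals v (var j)    = almost-all λ i → sym (lookup-map j (val i) v)
      eval-vals v (fun g ts) = almost-map₂ (λ i eq eqs → trans eq (cong (funᴹ M g) eqs))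
                                 (agree (rep-[] (apply (funᴹ M g) (evals power-structure v ts)))) (evals-vals v ts)

      evals-vals : ∀ {n k} (v : Vec _/~ n) (ts : Vec (Term L n) k) →
                   Almost limit λ i → vals i (evals power-structure v ts) ≡ evals M (vals i v) ts
      evals-vals v []       = almost-all λ _ → refl
      evals-vals v (t ∷ ts) = almost-map₂ (λ _ → cong₂ Vec._∷_) (eval-vals v t) (evals-vals v ts)

    -- Implication uses that the ultrafilter decides every predicate. For a quantifier that fails,
    -- pointwise counterexamples are assembled into one element of the limit power.
    Łoś : ∀ {n} (ψ : Formula L n) (v : Vec _/~ n) →
          (power-structure ⊨ ψ [ v ]) ⇔ Almost limit (λ i → M ⊨ ψ [ vals i v ])
    Łoś false v = mk⇔ (λ ()) λ h → Level.lift (Level.lower (proj₂ (almost-exists h)))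
    Łoś (s ≐ t) v = mk⇔
      (λ eq → almost-map₂ (λ i es et → trans (sym es) (trans (cong (val i) eq) et)) (eval-vals v s) (eval-vals v t))
      (λ h → rep-~ (agreeing (almost-map₂ (λ i e et → trans e (sym et))
                      (almost-map₂ (λ i → trans) (eval-vals v s) h) (eval-vals v t))))
    Łoś (rel r ts) v = mk⇔
      (almost-map₂ (λ i → subst (relᴹ M r)) (evals-vals v ts))
      (almost-map₂ (λ i eq → subst (relᴹ M r) (sym eq)) (evals-vals v ts))
    Łoś (ψ ⇒ χ) v = mk⇔
      (λ h → almost-⇒ λ p → to (Łoś χ v) (h (from (Łoś ψ v) p)))
      (λ h p → from (Łoś χ v) (almost-map₂ (λ _ f → f) h (to (Łoś ψ v) p)))
    Łoś (all ψ) v = mk⇔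
      (λ h → stable λ ¬∀ → proj₂ (almost-exists (almost-map₂
        (λ i (eq , ψc) fails → refute (vals i v) em fails (subst (λ z → M ⊨ ψ [ z ∷ vals i v ]) eq ψc))
        (almost-map₂ (λ i → _,_) (agree (rep-[] counterexample)) (to (Łoś ψ ([ counterexample ]ᴱ ∷ v)) (h _)))
        (almost-¬ ¬∀))))
      (λ h c → from (Łoś ψ (c ∷ v)) (almost-map (λ i f → f (val i c)) h))
      where
      pick-failure : ∀ w → Dec (∃[ z ] ¬ (M ⊨ ψ [ z ∷ w ])) → Carrier M
      pick-failure w (yes (z , _)) = z
      pick-failure w (no _)        = inhabited M
      -- The choice is a function of the values of `v` alone, not of the index, and so inherits
      -- finite support.
      counterexample : Element
      counterexample = apply (λ w → pick-failure w em) v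
      refute : ∀ w d → ¬ (∀ z → M ⊨ ψ [ z ∷ w ]) → ¬ (M ⊨ ψ [ pick-failure w d ∷ w ])
      refute w (yes (_ , ¬ψ)) _     = ¬ψ
      refute w (no none)      fails = contradiction (¬∀⟶∃¬ fails) none

    translateᴱ : ℤ → Element → Element
    translateᴱ n (f , supp) = f ∘ translateᴵ n , λ k →
      let s , eq = supp k in ∣ n ∣ + s , λ m → SupportedIn-translate n (eq m)

    translateᴱ-translateᴱ : ∀ m n e → translateᴱ m (translateᴱ n e) ~ translateᴱ (m ℤ.+ n) e
    translateᴱ-translateᴱ m n (f , _) = agreeing (almost-all λ (k , x , l) →
      cong (λ y → f (k , y , l)) (translate-translate n m x))

    translateᴱ-0 : ∀ e → translateᴱ ℤ.0ℤ e ~ e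
    translateᴱ-0 (f , _) = agreeing (almost-all λ (k , x , l) → cong (λ y → f (k , y , l)) (translate-0 x))

    -- Equality of two elements is read as one predicate of a pair, to which shift invariance
    -- applies. The forward direction makes `σ-to` compatible with classes; the backward one does
    -- the same for `σ-from`.
    shift-~ : ∀ e e′ → (e ~ e′) ⇔ (translateᴱ ℤ.1ℤ e ~ translateᴱ ℤ.1ℤ e′)
    shift-~ e e′ = mk⇔ (λ h → agreeing (to invariant (agree h)))
                       (λ h → agreeing (from invariant (agree h)))
      where
      invariant = almost-shift (λ w → head w ≡ head (tail w)) (λ i → e at i ∷ e′ at i ∷ [])
                    (supported-∷ (proj₂ e) (supported-∷ (proj₂ e′) λ k → 0 , λ _ _ → refl))

    shift-unshift : ∀ e → translateᴱ ℤ.1ℤ (translateᴱ ℤ.-1ℤ e) ~ e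
    shift-unshift e = ~-trans (translateᴱ-translateᴱ ℤ.1ℤ ℤ.-1ℤ e) (translateᴱ-0 e)

    unshift-shift : ∀ e → translateᴱ ℤ.-1ℤ (translateᴱ ℤ.1ℤ e) ~ e
    unshift-shift e = ~-trans (translateᴱ-translateᴱ ℤ.-1ℤ ℤ.1ℤ e) (translateᴱ-0 e)

    unshift-cong : ∀ e e′ → e ~ e′ → translateᴱ ℤ.-1ℤ e ~ translateᴱ ℤ.-1ℤ e′
    unshift-cong e e′ e~e′ = from (shift-~ (translateᴱ ℤ.-1ℤ e) (translateᴱ ℤ.-1ℤ e′))
      (~-trans (shift-unshift e) (~-trans e~e′ (~-sym (shift-unshift e′))))

    σ-to σ-from : _/~ → _/~
    σ-to   c = [ translateᴱ ℤ.1ℤ (rep c) ]ᴱ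
    σ-from c = [ translateᴱ ℤ.-1ℤ (rep c) ]ᴱ

    σ-to-[] : ∀ e → σ-to [ e ]ᴱ ≡ [ translateᴱ ℤ.1ℤ e ]ᴱ
    σ-to-[] e = []-cong (to (shift-~ (rep [ e ]ᴱ) e) (rep-[] e))

    σ-from-[] : ∀ e → σ-from [ e ]ᴱ ≡ [ translateᴱ ℤ.-1ℤ e ]ᴱ
    σ-from-[] e = []-cong (unshift-cong (rep [ e ]ᴱ) e (rep-[] e))

    vals-σ : ∀ {n} (v : Vec _/~ n) →
             Almost limit λ i → vals i (map σ-to v) ≡ vals (translateᴵ ℤ.1ℤ i) v
    vals-σ []      = almost-all λ _ → refl
    vals-σ (c ∷ v) = almost-map₂ (λ _ → cong₂ Vec._∷_) (agree (rep-[] (translateᴱ ℤ.1ℤ (rep c)))) (vals-σ v)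

    σ-to-from : ∀ c → σ-to (σ-from c) ≡ c
    σ-to-from c = trans (σ-to-[] (translateᴱ ℤ.-1ℤ (rep c)))
                        (trans ([]-cong (shift-unshift (rep c))) ([]-rep c))

    σ-from-to : ∀ c → σ-from (σ-to c) ≡ c
    σ-from-to c = trans (σ-from-[] (translateᴱ ℤ.1ℤ (rep c)))
                        (trans ([]-cong (unshift-shift (rep c))) ([]-rep c))

    σ-fun : ∀ {k} (g : Fun L k) v → σ-to (funᴹ power-structure g v) ≡ funᴹ power-structure g (map σ-to v)
    σ-fun g v = trans (σ-to-[] (apply (funᴹ M g) v)) ([]-cong agrees)
      where
      agrees : translateᴱ ℤ.1ℤ (apply (funᴹ M g) v) ~ apply (funᴹ M g) (map σ-to v)
      agrees = agreeing (almost-map (λ i eq → cong (funᴹ M g) (sym eq)) (vals-σ v))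

    σ-rel : ∀ {k} (r : Rel L k) v → relᴹ power-structure r v ⇔ relᴹ power-structure r (map σ-to v)
    σ-rel r v = mk⇔
      (λ h → almost-map₂ (λ i eq → subst (relᴹ M r) (sym eq)) (vals-σ v) (to invariant h))
      (λ h → from invariant (almost-map₂ (λ i → subst (relᴹ M r)) (vals-σ v) h))
      where
      invariant : Almost limit (λ i → relᴹ M r (vals i v)) ⇔ Almost limit (λ i → relᴹ M r (vals (translateᴵ ℤ.1ℤ i) v))
      invariant = almost-shift (relᴹ M r) (λ i → vals i v) (supported-vals v)

    σ : Automorphism power-structure
    σ = record
      { bijection     = mk↔ₛ′ σ-to σ-from σ-to-from σ-from-to
      ; fun-preserved = σ-fun
      ; rel-preserved = σ-rel
      }

    power-+ : ∀ n e → iterate σ-to [ e ]ᴱ n ≡ [ translateᴱ (+ n) e ]ᴱ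
    power-+ zero    e = []-cong (~-sym (translateᴱ-0 e))
    power-+ (suc n) e = begin
      iterate σ-to (σ-to [ e ]ᴱ) n           ≡⟨ cong (λ c → iterate σ-to c n) (σ-to-[] e) ⟩
      iterate σ-to [ translateᴱ ℤ.1ℤ e ]ᴱ n  ≡⟨ power-+ n (translateᴱ ℤ.1ℤ e) ⟩
      [ translateᴱ (+ n) (translateᴱ ℤ.1ℤ e) ]ᴱ  ≡⟨ []-cong (translateᴱ-translateᴱ (+ n) ℤ.1ℤ e) ⟩
      [ translateᴱ (+ n ℤ.+ ℤ.1ℤ) e ]ᴱ       ≡⟨ cong (λ z → [ translateᴱ z e ]ᴱ) (ℤₚ.+-comm (+ n) ℤ.1ℤ) ⟩
      [ translateᴱ (+ suc n) e ]ᴱ            ∎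
      where open ≡-Reasoning

    power-- : ∀ n e → iterate σ-from [ e ]ᴱ n ≡ [ translateᴱ (ℤ.- (+ n)) e ]ᴱ
    power-- zero    e = []-cong (~-sym (translateᴱ-0 e))
    power-- (suc n) e = begin
      iterate σ-from (σ-from [ e ]ᴱ) n             ≡⟨ cong (λ c → iterate σ-from c n) (σ-from-[] e) ⟩
      iterate σ-from [ translateᴱ ℤ.-1ℤ e ]ᴱ n     ≡⟨ power-- n (translateᴱ ℤ.-1ℤ e) ⟩
      [ translateᴱ (ℤ.- (+ n)) (translateᴱ ℤ.-1ℤ e) ]ᴱ  ≡⟨ []-cong (translateᴱ-translateᴱ (ℤ.- (+ n)) ℤ.-1ℤ e) ⟩
      [ translateᴱ (ℤ.- (+ n) ℤ.+ ℤ.-1ℤ) e ]ᴱ      ≡⟨ cong (λ z → [ translateᴱ z e ]ᴱ) (trans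
                                                       (ℤₚ.+-comm (ℤ.- (+ n)) ℤ.-1ℤ) (sym (ℤₚ.neg-suc n))) ⟩
      [ translateᴱ (ℤ.- (+ suc n)) e ]ᴱ            ∎
      where open ≡-Reasoning

    power-[] : ∀ n e → power σ n [ e ]ᴱ ≡ [ translateᴱ n e ]ᴱ
    power-[] (+ n)    e = power-+ n e
    power-[] -[1+ n ] e = power-- (suc n) e

    components : ∀ {n} (f : Index → Vec (Carrier M) n) → FinitelySupported f → Vec Element n
    components {zero}  f supp = []
    components {suc n} f supp = (head ∘ f , supported-∘ head supp)
                              ∷ components (tail ∘ f) (supported-∘ tail supp)

    vals-components : ∀ {n} z (f : Index → Vec (Carrier M) n) supp →
      Almost limit λ i → vals i (map (power σ z ∘ [_]ᴱ) (components f supp)) ≡ f (translateᴵ z i)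
    vals-components {zero}  z f supp = almost-all λ i → case-[] (f (translateᴵ z i))
      where
      case-[] : (w : Vec (Carrier M) 0) → [] ≡ w
      case-[] [] = refl
    vals-components {suc n} z f supp = almost-map₂
      (λ i eq eqs → trans (cong₂ Vec._∷_ (trans (cong (val i) (power-[] z (head ∘ f , supported-∘ head supp))) eq) eqs) (head∷tail (f (translateᴵ z i))))
      (agree (rep-[] (translateᴱ z (head ∘ f , supported-∘ head supp))))
      (vals-components z (tail ∘ f) (supported-∘ tail supp))
      where
      head∷tail : (w : Vec (Carrier M) (suc n)) → head w ∷ tail w ≡ w
      head∷tail (_ ∷ _) = refl

  -- Realizing every binary sequence over one parameter

  truncate : ℕ → Seq → Seq
  truncate k x i = if ⌊ Within k i ⌋ then x i else 0

  truncate-within : ∀ k x i → Within k i → truncate k x i ≡ x i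
  truncate-within k x i w with em {P = Within k i}
  ... | yes _ = refl
  ... | no ¬w = contradiction w ¬w

  truncate-supported : ∀ k → truncate k SupportedIn Within k
  truncate-supported k {x} {y} agree = fe λ i → pointwise i
    where
    pointwise : ∀ i → truncate k x i ≡ truncate k y i
    pointwise i with em {P = Within k i}
    ... | yes w = agree i w
    ... | no _  = refl

  neg-within : ∀ {k} i → Within k i → Within k (ℤ.- i)
  neg-within {k} i = subst (_≤ k) (sym (ℤₚ.∣-i∣≡∣i∣ i))

  module _ {L : Language ℓ} (M : Structure L) (p q : ℕ) (φ : Formula L (p + q))
           (shatters : Shatters (λ x y → instanceAt {p = p} M φ y x)) where

    open LimitPower M

    R : Vec (Carrier M) p → Vec (Carrier M) q → Set ℓ
    R x y = M ⊨ φ [ x ++ y ]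

    dual-shatters : Shatters (flip R)
    dual-shatters = dual R shatters

    pick-param : ∀ m v → Dec (v < m) → Vec (Carrier M) q
    pick-param m v (yes v<m) = proj₁ (dual-shatters m) (fromℕ< v<m)
    pick-param m v (no _)    = Vec.replicate q (inhabited M)

    param : ℕ → ℕ → Vec (Carrier M) q
    param m v = pick-param m v em

    param-< : ∀ m v (v<m : v < m) → param m v ≡ proj₁ (dual-shatters m) (fromℕ< v<m)
    param-< m v v<m with em {P = v < m}
    ... | yes _   = refl
    ... | no v≮m = contradiction v<m v≮m

    b-fun : Index → Vec (Carrier M) q
    b-fun (k , x , m) = param m (x ℤ.0ℤ)

    b-supported : FinitelySupported b-fun
    b-supported k = 0 , λ m agree → cong (param m) (agree ℤ.0ℤ ≤-refl)

    -- The sign is fixed by the action of `σ`: when `y` is `x` translated by `n`, the entry of `y`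
    -- at `- n` is `x ℤ.0ℤ`, which names the parameter in `b-fun`.
    Realizes : 2^ℤ → ℕ → Seq → ℕ → Vec (Carrier M) p → Set ℓ
    Realizes s k y m u = ∀ i → Within k i → R u (param m (y (ℤ.- i))) ⇔ (s i ≡ true)

    pick-realizer : ∀ s k y m → Dec (∃[ u ] Realizes s k y m u) → Vec (Carrier M) p
    pick-realizer s k y m (yes (u , _)) = u
    pick-realizer s k y m (no _)        = Vec.replicate p (inhabited M)

    pick-realizes : ∀ s k y m d → ∃[ u ] Realizes s k y m u → Realizes s k y m (pick-realizer s k y m d)
    pick-realizes s k y m (yes (_ , h)) _ = h
    pick-realizes s k y m (no none)     e = contradiction e none

    -- A realizer chosen from `x` itself could depend on all coordinates; choosing it from the
    -- truncation forces finite support.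
    a-fun : 2^ℤ → Index → Vec (Carrier M) p
    a-fun s (k , x , m) = pick-realizer s k (truncate k x) m em

    a-supported : ∀ s → FinitelySupported (a-fun s)
    a-supported s k = k , λ m agree → cong (λ y → pick-realizer s k y m em) (truncate-supported k agree)

    -- The bound places all parameters in the shattered family of size `m`; injectivity of `y`
    -- prevents one parameter from being both required and forbidden.
    realizable : ∀ s k y m → InjectiveWithin k y → (∀ i → Within k i → y i < m) → ∃[ u ] Realizes s k y m u
    realizable s k y m inj bound = u , realizes
      where
      selected : ℕ → Set
      selected v = ∃[ i ] (Within k i × y (ℤ.- i) ≡ v × s i ≡ true)
      J : Subset m
      J = tabulate λ v → ⌊ selected (toℕ v) ⌋
      u = proj₁ (proj₂ (dual-shatters m) J)
      realizes : Realizes s k y m u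
      realizes i w = ⇔-trans (≡⇒⇔ (R u) (param-< m _ v<m)) (⇔-trans (proj₂ (proj₂ (dual-shatters m) J) (fromℕ< v<m))
        (⇔-trans (∈⇔lookup _ J) (⇔-trans (≡⇒⇔ (_≡ true) (lookup∘tabulate _ (fromℕ< v<m)))
          (mk⇔ (select ∘ ⌊⌋-holds) (λ si → ⌊⌋-true (i , w , sym (toℕ-fromℕ< v<m) , si))))))
        where
        v<m : y (ℤ.- i) < m
        v<m = bound (ℤ.- i) (neg-within i w)
        select : selected (toℕ (fromℕ< v<m)) → s i ≡ true
        select (j , wj , eq , sj) = subst (λ z → s z ≡ true)
          (ℤₚ.neg-injective (inj (ℤ.- j) (ℤ.- i) (neg-within j wj) (neg-within i w) (trans eq (toℕ-fromℕ< v<m)))) sj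

    realized-almost : ∀ s n → Almost limit λ i → R (a-fun s (translateᴵ n i)) (b-fun i) ⇔ (s n ≡ true)
    -- Taking `k` at least `∣ n ∣` puts `n` among the positions realized, and radius `∣ n ∣ + k`
    -- covers the window of radius `k` after translation by `n`.
    realized-almost s n = almost-limit (eventually ∣ n ∣ λ k n≤k → ∣ n ∣ + k , λ x inj →
      let N , below = bounded-within x (∣ n ∣ + k) in N , λ m N≤m → realized k n≤k x inj m λ i w → ≤-trans (below i w) N≤m)
      where
      realized : ∀ k → ∣ n ∣ ≤ k → ∀ x → InjectiveWithin (∣ n ∣ + k) x →
                 ∀ m → (∀ i → Within (∣ n ∣ + k) i → x i < m) →
                 R (a-fun s (k , translate n x , m)) (param m (x ℤ.0ℤ)) ⇔ (s n ≡ true)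
      realized k n≤k x inj m bound = ⇔-trans
        (≡⇒⇔ (λ v → R (a-fun s (k , translate n x , m)) (param m v)) (sym at-n))
        (pick-realizes s k y m em (realizable s k y m y-inj y-bound) n n≤k)
        where
        y = truncate k (translate n x)
        at : ∀ i → Within k i → y i ≡ x (n ℤ.+ i)
        at = truncate-within k (translate n x)
        at-n : y (ℤ.- n) ≡ x ℤ.0ℤ
        at-n = trans (at (ℤ.- n) (neg-within n n≤k)) (cong x (ℤₚ.+-inverseʳ n))
        y-bound : ∀ i → Within k i → y i < m
        y-bound i w = subst (_< m) (sym (at i w)) (bound (n ℤ.+ i) (+-within n i w))
        y-inj : InjectiveWithin k y
        y-inj i j wi wj eq = trans (sym (cancel i)) (trans (cong (λ z → ℤ.- n ℤ.+ z)
          (inj (n ℤ.+ i) (n ℤ.+ j) (+-within n i wi) (+-within n j wj) (trans (sym (at i wi)) (trans eq (at j wj))))) (cancel j))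
          where
          cancel : ∀ i → ℤ.- n ℤ.+ (n ℤ.+ i) ≡ i
          cancel i = trans (sym (ℤₚ.+-assoc (ℤ.- n) n i))
            (trans (cong (ℤ._+ i) (ℤₚ.+-inverseˡ n)) (ℤₚ.+-identityˡ i))

    parameter : Vec (Carrier power-structure) q
    parameter = map [_]ᴱ (components b-fun b-supported)

    point-of : 2^ℤ → Vec (Carrier power-structure) p
    point-of s = map [_]ᴱ (components (a-fun s) (a-supported s))

    vals-instance : ∀ s n → Almost limit λ i →
      vals i (map (power σ n) (point-of s) ++ parameter) ≡ a-fun s (translateᴵ n i) ++ b-fun i
    vals-instance s n = almost-map₂
      (λ i eqa eqb → trans (map-++ (val i) (map (power σ n) (point-of s)) parameter)
        (cong₂ _++_ (trans (cong (vals i) (sym (map-∘ (power σ n) [_]ᴱ (components (a-fun s) (a-supported s))))) eqa) eqb))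
      (vals-components n (a-fun s) (a-supported s))
      -- At exponent zero `power` is the identity, and `b-fun` reads only coordinate zero, which
      -- translation by zero leaves in place by computation.
      (vals-components ℤ.0ℤ b-fun b-supported)

    full-image : ∀ s → ξ-image {p = p} σ (instanceAt power-structure φ parameter) s
    full-image s = point-of s , λ n → mk⇔
      (λ sn → from (Łoś φ (map (power σ n) (point-of s) ++ parameter)) (almost-map₂
        (λ i eq iff → subst (λ v → M ⊨ φ [ v ]) (sym eq) (from iff sn)) (vals-instance s n) (realized-almost s n)))
      -- The goal `s n ≡ true` does not mention the index, so one index at which all three
      -- almost-sure facts hold is enough.
      (λ h → proj₂ (almost-exists (almost-map₂ (λ i (eq , hi) iff → to iff (subst (λ v → M ⊨ φ [ v ]) eq hi))
        (almost-map₂ (λ i → _,_) (vals-instance s n) (to (Łoś φ (map (power σ n) (point-of s) ++ parameter)) h))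
        (realized-almost s n))))

  IP⇒full : {L : Language ℓ} (T : Theory L) (p q : ℕ) (φ : Formula L (p + q)) → HasIP T p q φ → SomeFullImage T p q φ
  IP⇒full T p q φ (𝓜 , shatters) = record
    { structure = power-structure
    ; satisfies = λ ψ ψ∈T → from (Łoś ψ []) (almost-all λ _ → satisfies 𝓜 ψ ψ∈T)
    } , parameter M p q φ shatters , σ , full-image M p q φ shatters
    where
    M = structure 𝓜
    open LimitPower M

theorem4p8 : (∀ {a : Level} → ExcludedMiddle a) →
    (∀ {a b : Level} → Extensionality a b) →
    ∀ {ℓ : Level} (L : Language ℓ) (T : Theory L) → IsComplete T →
    ∀ (p q : ℕ) (φ : Formula L (p + q)) →
    (HasIP T p q φ ⇔ SomeDenseImage T p q φ) ×
    (HasIP T p q φ ⇔ AllFiniteBlocksAppear T p q φ) ×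
    (HasIP T p q φ ⇔ SomeUniversalSequence T p q φ) ×
    (HasIP T p q φ ⇔ SomeFullImage T p q φ) ×
    (HasIP T p q φ ⇔ SomeDenseρ T p q φ)
theorem4p8 em fe L T _ p q φ =
  mk⇔ (full⇒denseImage T p q φ ∘ full) (denseImage⇒IP T p q φ) ,
  mk⇔ (full⇒blocksAppear T p q φ ∘ full) (blocksAppear⇒IP T p q φ) ,
  mk⇔ (full⇒universal T p q φ ∘ full) (universal⇒IP T p q φ) ,
  mk⇔ full (universal⇒IP T p q φ ∘ full⇒universal T p q φ) ,
  mk⇔ (full⇒denseρ T p q φ ∘ full) (denseρ⇒IP T p q φ)
  where
  full : HasIP T p q φ → SomeFullImage T p q φ
  full = Classical.IP⇒full em fe T p q φ
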